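{- For all integers $n\ge 0$, the Lucas-Fubini number $\mathcal{L}_n$ satisfies the Dobiński-like formula $$\mathcal{L}_n=\frac{\alpha}{e^{\alpha}}\sum_{k\geq 0} \frac{\alpha^k k^n}{k!}+\frac{\beta}{e^{\beta}}\sum_{k\geq 0} \frac{\beta^k k^n}{k!}.$$
   Context: $\alpha=(1+\sqrt5)/2$ and $\beta=(1-\sqrt5)/2$. Convention: $0^0=1$. ${n\brace k}$ denotes the Stirling number of the second kind (the number of partitions of an $n$-element set into exactly $k$ non-empty blocks). $L_m$ denotes the Lucas numbers: $L_0=2$, $L_1=1$, $L_m=L_{m-1}+L_{m-2}$ for $m\ge2$. The Lucas-Fubini numbers are defined by $\mathcal{L}_n=\sum_{k=0}^n L_{k+1}{n\brace k}$ for $n\ge0$. -}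

module Defs where

open import Algebra.Bundles.Raw using (RawSemiring)
import Algebra.Definitions.RawSemiring as SemiringDefs
open import Data.Fin.Properties using (all?)
open import Data.Fin.Subset using (Subset; inside; outside; Nonempty; Empty; _∩_; _∈_)
open import Data.Fin.Subset.Properties using (nonempty?; _∈?_)
open import Data.Integer.Base as ℤ using (+_)
import Data.Integer.Properties as ℤ
open import Data.List.Base using (List; []; _∷_; _++_; map; length; filter; upTo)
open import Data.List.Relation.Unary.All as All using (All)
open import Data.List.Relation.Unary.AllPairs as AllPairs using (AllPairs)
open import Data.List.Relation.Unary.Any as Any using (Any)
open import Data.Nat.Base as ℕ using (ℕ; zero; suc; _!)
open import Data.Nat.ListAction using (sum)
import Data.Nat.Properties as ℕ
import Data.Nat.Coprimality as Coprimality
open import Data.Product.Base using (∃-syntax; _×_; _,_; proj₁; proj₂)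
open import Data.Rational.Base as ℚ using (ℚ; 0ℚ; 1ℚ)
import Data.Rational.Properties as ℚ
import Data.Rational.Unnormalised.Base as ℚᵘ
import Data.Rational.Unnormalised.Properties as ℚᵘ
open import Data.Rational.Solver using (module +-*-Solver)
open import Data.Sum.Base using (_⊎_; inj₁; inj₂)
import Data.Vec.Base as Vec
open import Function.Base using (_∘_)
open import Level using (0ℓ)
open import Relation.Binary.PropositionalEquality
open import Relation.Nullary using (¬_; yes; no; ¬?; contradiction; _×-dec_)
open import Relation.Unary using (Decidable)

subsets : ∀ n → List (Subset n)
subsets zero    = Vec.[] ∷ []
subsets (suc n) = map (outside Vec.∷_) (subsets n) ++ map (inside Vec.∷_) (subsets n)

-- For xs without repetitions, choose k xs contains each k-element subset
-- of xs exactly once, as the list of its elements in the order of xs, so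
-- that a family of subsets is counted only once in stirling₂.
choose : ∀ {A : Set} → ℕ → List A → List (List A)
choose zero    _        = [] ∷ []
choose (suc k) []       = []
choose (suc k) (x ∷ xs) = map (x ∷_) (choose k xs) ++ choose (suc k) xs

Disjoint : ∀ {n} → Subset n → Subset n → Set
Disjoint p q = Empty (p ∩ q)

IsPartition : ∀ {n} → List (Subset n) → Set
IsPartition bs = All Nonempty bs × AllPairs Disjoint bs × (∀ x → Any (x ∈_) bs)

isPartition? : ∀ {n} → Decidable (IsPartition {n})
isPartition? bs =
  All.all? nonempty? bs ×-dec
  AllPairs.allPairs? (λ p q → ¬? (nonempty? (p ∩ q))) bs ×-dec
  all? (λ x → Any.any? (x ∈?_) bs)

stirling₂ : ℕ → ℕ → ℕ
stirling₂ n k = length (filter isPartition? (choose k (subsets n)))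

lucas : ℕ → ℕ
lucas 0             = 2
lucas 1             = 1
lucas (suc (suc m)) = lucas (suc m) ℕ.+ lucas m

lucasFubini : ℕ → ℕ
lucasFubini n = sum (map (λ k → lucas (suc k) ℕ.* stirling₂ n k) (upTo (suc n)))

module RationalFacts where
  open import Data.Rational.Base using (_+_; _*_; _-_; -_; _≤_; _<_; ∣_∣; 1/_)
  open ℚ.≤-Reasoning
  open +-*-Solver

  ι : ℕ → ℚ
  ι n = ℚ.mkℚ (+ n) 0 (Coprimality.sym (Coprimality.1-coprimeTo n))

  /1≡ι : ∀ n → + n ℚ./ 1 ≡ ι n
  /1≡ι n = ℚ.normalize-coprime (Coprimality.sym (Coprimality.1-coprimeTo n))

  ι-+ : ∀ m n → ι (m ℕ.+ n) ≡ ι m + ι n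
  ι-+ m n = trans (sym (/1≡ι (m ℕ.+ n)))
    (cong (ℚ._/ 1) (cong₂ ℤ._+_ (sym (ℤ.*-identityʳ (+ m))) (sym (ℤ.*-identityʳ (+ n)))))

  ι-* : ∀ m n → ι (m ℕ.* n) ≡ ι m * ι n
  ι-* m n = trans (sym (/1≡ι (m ℕ.* n))) (cong (ℚ._/ 1) (ℤ.pos-* m n))

  ι-mono-≤ : ∀ {m n} → m ℕ.≤ n → ι m ≤ ι n
  ι-mono-≤ m≤n = ℚ.*≤* (ℤ.*-monoʳ-≤-nonNeg (+ 1) (ℤ.+≤+ m≤n))

  ι-mono-< : ∀ {m n} → m ℕ.< n → ι m < ι n
  ι-mono-< m<n = ℚ.*<* (ℤ.*-monoʳ-<-pos (+ 1) (ℤ.+<+ m<n))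

  0≤ι : ∀ n → 0ℚ ≤ ι n
  0≤ι n = ι-mono-≤ ℕ.z≤n

  0<ι : ∀ n → 0ℚ < ι (suc n)
  0<ι n = ι-mono-< {0} (ℕ.s≤s ℕ.z≤n)

  archimedean : ∀ p → ∃[ n ] p < ι n
  archimedean (ℚ.mkℚ (+ n) d _) = suc n ,
    ℚ.*<* (subst (ℤ._< + suc n ℤ.* + suc d) (sym (ℤ.*-identityʳ (+ n)))
      (ℤ.+<+ (ℕ.s≤s (ℕ.≤-trans (ℕ.m≤m*n n (suc d)) (ℕ.m≤n+m _ d)))))
  archimedean p@(ℚ.mkℚ (ℤ.-[1+ n ]) d _) = 0 , ℚ.negative⁻¹ p

  /-*-cancel : ∀ a n → (+ a ℚ./ suc n) * ι (suc n) ≡ ι a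
  /-*-cancel a n = ℚ.toℚᵘ-injective eq
    where
    open ℚᵘ.≃-Reasoning renaming (begin_ to begin′_; _∎ to _∎′)
    eq : ℚ.toℚᵘ ((+ a ℚ./ suc n) * ι (suc n)) ℚᵘ.≃ ℚ.toℚᵘ (ι a)
    eq = begin′
      ℚ.toℚᵘ ((+ a ℚ./ suc n) * ι (suc n))
        ≈⟨ ℚ.toℚᵘ-homo-* (+ a ℚ./ suc n) (ι (suc n)) ⟩
      ℚ.toℚᵘ (+ a ℚ./ suc n) ℚᵘ.* ℚ.toℚᵘ (ι (suc n))
        ≈⟨ ℚᵘ.*-cong (ℚ.toℚᵘ-fromℚᵘ (ℚᵘ.mkℚᵘ (+ a) n)) ℚᵘ.≃-refl ⟩
      ℚᵘ.mkℚᵘ (+ a) n ℚᵘ.* ℚᵘ.mkℚᵘ (+ suc n) 0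
        ≈⟨ ℚᵘ.*≡* (trans (ℤ.*-identityʳ (+ a ℤ.* + suc n))
             (cong (λ d → + a ℤ.* + d) (sym (ℕ.*-identityʳ (suc n))))) ⟩
      ℚᵘ.mkℚᵘ (+ a) 0 ∎′

  <⇒≱ : ∀ {p q} → p < q → ¬ (q ≤ p)
  <⇒≱ p<q q≤p = ℚ.<-irrefl refl (ℚ.<-≤-trans p<q q≤p)

  *-nonNeg : ∀ {p q} → 0ℚ ≤ p → 0ℚ ≤ q → 0ℚ ≤ p * q
  *-nonNeg {p} {q} 0≤p 0≤q =
    ℚ.nonNegative⁻¹ (p * q) {{ℚ.nonNeg*nonNeg⇒nonNeg p {{ℚ.nonNegative 0≤p}} q {{ℚ.nonNegative 0≤q}}}}

  *-pos : ∀ {p q} → 0ℚ < p → 0ℚ < q → 0ℚ < p * q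
  *-pos {p} {q} 0<p 0<q =
    ℚ.positive⁻¹ (p * q) {{ℚ.pos*pos⇒pos p {{ℚ.positive 0<p}} q {{ℚ.positive 0<q}}}}

  *-monoʳ : ∀ {p q r} → 0ℚ ≤ r → p ≤ q → p * r ≤ q * r
  *-monoʳ {r = r} 0≤r = ℚ.*-monoʳ-≤-nonNeg r {{ℚ.nonNegative 0≤r}}

  *-monoˡ : ∀ {p q r} → 0ℚ ≤ r → p ≤ q → r * p ≤ r * q
  *-monoˡ {r = r} 0≤r = ℚ.*-monoˡ-≤-nonNeg r {{ℚ.nonNegative 0≤r}}

  *-mono : ∀ {p q r s} → 0ℚ ≤ q → 0ℚ ≤ r → p ≤ q → r ≤ s → p * r ≤ q * s
  *-mono 0≤q 0≤r p≤q r≤s = ℚ.≤-trans (*-monoʳ 0≤r p≤q) (*-monoˡ 0≤q r≤s)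

  *-mono-<ʳ : ∀ {p q r} → 0ℚ < r → p < q → p * r < q * r
  *-mono-<ʳ {r = r} 0<r = ℚ.*-monoˡ-<-pos r {{ℚ.positive 0<r}}

  *-cancelʳ-≤ : ∀ {p q} r → 0ℚ < r → p * r ≤ q * r → p ≤ q
  *-cancelʳ-≤ r 0<r = ℚ.*-cancelʳ-≤-pos r {{ℚ.positive 0<r}}

  *-cancelʳ-< : ∀ {p q} r → 0ℚ ≤ r → p * r < q * r → p < q
  *-cancelʳ-< r 0≤r = ℚ.*-cancelʳ-<-nonNeg r {{ℚ.nonNegative 0≤r}}

  -- Sends 0 to 0.
  recip : ℚ → ℚ
  recip p with p ℚ.≟ 0ℚ
  ... | yes _   = 0ℚ
  ... | no  p≢0 = (1/ p) {{ℚ.≢-nonZero p≢0}}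

  recip-inverse : ∀ {p} → p ≢ 0ℚ → recip p * p ≡ 1ℚ
  recip-inverse {p} p≢0 with p ℚ.≟ 0ℚ
  ... | yes p≡0  = contradiction p≡0 p≢0
  ... | no  p≢0′ = ℚ.*-inverseˡ p {{ℚ.≢-nonZero p≢0′}}

  recip-pos : ∀ {p} → 0ℚ < p → 0ℚ < recip p
  recip-pos {p} 0<p = ℚ.≰⇒> λ r≤0 → <⇒≱ 0<1 (begin
    1ℚ          ≡⟨ recip-inverse (ℚ.<⇒≢ 0<p ∘ sym) ⟨
    recip p * p ≤⟨ *-monoʳ (ℚ.<⇒≤ 0<p) r≤0 ⟩
    0ℚ * p      ≡⟨ ℚ.*-zeroˡ p ⟩
    0ℚ          ∎)
    where
    0<1 : 0ℚ < 1ℚ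
    0<1 = ℚ.*<* (ℤ.+<+ (ℕ.s≤s ℕ.z≤n))

  ε-archimedean : ∀ p {ε} → 0ℚ < ε → ∃[ n ] p < ε * ι n
  ε-archimedean p {ε} 0<ε with archimedean (p * recip ε)
  ... | n , p/ε<n = n , (begin-strict
    p                 ≡⟨ ℚ.*-identityʳ p ⟨
    p * 1ℚ            ≡⟨ cong (p *_) (recip-inverse (ℚ.<⇒≢ 0<ε ∘ sym)) ⟨
    p * (recip ε * ε) ≡⟨ ℚ.*-assoc p (recip ε) ε ⟨
    p * recip ε * ε   <⟨ *-mono-<ʳ 0<ε p/ε<n ⟩
    ι n * ε           ≡⟨ ℚ.*-comm (ι n) ε ⟩
    ε * ι n           ∎)

  third : ℚ → ℚ
  third ε = ε * (+ 1 ℚ./ 3)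

  third-pos : ∀ {ε} → 0ℚ < ε → 0ℚ < third ε
  third-pos 0<ε = *-pos 0<ε (ℚ.positive⁻¹ (+ 1 ℚ./ 3))

  thirds : ∀ ε → third ε + third ε + third ε ≡ ε
  thirds = solve 1 (λ e → let t = e :* con (+ 1 ℚ./ 3) in t :+ t :+ t := e) refl

  two-thirds : ∀ {ε} → 0ℚ < ε → third ε + third ε < ε
  two-thirds {ε} 0<ε = begin-strict
    third ε + third ε           ≡⟨ ℚ.+-identityʳ _ ⟨
    third ε + third ε + 0ℚ      <⟨ ℚ.+-monoʳ-< (third ε + third ε) (third-pos 0<ε) ⟩
    third ε + third ε + third ε ≡⟨ thirds ε ⟩
    ε                           ∎

  ∣-∣-sym : ∀ p q → ∣ p - q ∣ ≡ ∣ q - p ∣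
  ∣-∣-sym p q = trans (sym (ℚ.∣-p∣≡∣p∣ (p - q)))
    (cong ∣_∣ (solve 2 (λ p q → :- (p :- q) := q :- p) refl p q))

  triangle : ∀ p q r → ∣ p - r ∣ ≤ ∣ p - q ∣ + ∣ q - r ∣
  triangle p q r = begin
    ∣ p - r ∣             ≡⟨ cong ∣_∣ (solve 3 (λ p q r → p :- r := (p :- q) :+ (q :- r)) refl p q r) ⟩
    ∣ (p - q) + (q - r) ∣ ≤⟨ ℚ.∣p+q∣≤∣p∣+∣q∣ (p - q) (q - r) ⟩
    ∣ p - q ∣ + ∣ q - r ∣ ∎

  ≤-∣∣ : ∀ p → p ≤ ∣ p ∣
  ≤-∣∣ p with ℚ.≤-total 0ℚ p
  ... | inj₁ 0≤p = ℚ.≤-reflexive (sym (ℚ.0≤p⇒∣p∣≡p 0≤p))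
  ... | inj₂ p≤0 = ℚ.≤-trans p≤0 (ℚ.0≤∣p∣ p)

  ∣-∣-< : ∀ {p q ε} → p < q + ε → q < p + ε → ∣ p - q ∣ < ε
  ∣-∣-< {p} {q} {ε} p<q+ε q<p+ε with ℚ.∣p∣≡p∨∣p∣≡-p (p - q)
  ... | inj₁ eq = begin-strict
    ∣ p - q ∣ ≡⟨ eq ⟩
    p - q     <⟨ ℚ.+-monoˡ-< (- q) p<q+ε ⟩
    q + ε - q ≡⟨ solve 2 (λ q e → q :+ e :- q := e) refl q ε ⟩
    ε         ∎
  ... | inj₂ eq = begin-strict
    ∣ p - q ∣ ≡⟨ eq ⟩
    - (p - q) ≡⟨ solve 2 (λ p q → :- (p :- q) := q :- p) refl p q ⟩
    q - p     <⟨ ℚ.+-monoˡ-< (- p) q<p+ε ⟩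
    p + ε - p ≡⟨ solve 2 (λ p e → p :+ e :- p := e) refl p ε ⟩
    ε         ∎

  <-+-∣-∣ : ∀ p {q ε} → ∣ p - q ∣ < ε → p < q + ε
  <-+-∣-∣ p {q} {ε} h = begin-strict
    p             ≡⟨ solve 2 (λ p q → p := q :+ (p :- q)) refl p q ⟩
    q + (p - q)   ≤⟨ ℚ.+-monoʳ-≤ q (≤-∣∣ (p - q)) ⟩
    q + ∣ p - q ∣ <⟨ ℚ.+-monoʳ-< q h ⟩
    q + ε         ∎

  ∣∣-∣-∣∣-< : ∀ p q {ε} → ∣ p - q ∣ < ε → ∣ ∣ p ∣ - ∣ q ∣ ∣ < ε
  ∣∣-∣-∣∣-< p q {ε} h = ∣-∣-< (lemma p q h) (lemma q p (subst (_< ε) (∣-∣-sym p q) h))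
    where
    lemma : ∀ p q → ∣ p - q ∣ < ε → ∣ p ∣ < ∣ q ∣ + ε
    lemma p q h = begin-strict
      ∣ p ∣             ≡⟨ cong ∣_∣ (solve 2 (λ p q → p := q :+ (p :- q)) refl p q) ⟩
      ∣ q + (p - q) ∣   ≤⟨ ℚ.∣p+q∣≤∣p∣+∣q∣ q (p - q) ⟩
      ∣ q ∣ + ∣ p - q ∣ <⟨ ℚ.+-monoʳ-< ∣ q ∣ h ⟩
      ∣ q ∣ + ε         ∎

  square-cancel-< : ∀ {p q} → 0ℚ ≤ q → p * p < q * q → p < q
  square-cancel-< {p} {q} 0≤q p²<q² = ℚ.≰⇒> λ q≤p →
    <⇒≱ p²<q² (*-mono (ℚ.≤-trans 0≤q q≤p) 0≤q q≤p q≤p)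

  1/suc : ℕ → ℚ
  1/suc n = + 1 ℚ./ suc n

  1/suc-pos : ∀ n → 0ℚ < 1/suc n
  1/suc-pos n = *-cancelʳ-< (ι (suc n)) (0≤ι (suc n)) (begin-strict
    0ℚ * ι (suc n)      ≡⟨ ℚ.*-zeroˡ (ι (suc n)) ⟩
    0ℚ                  <⟨ 0<ι 0 ⟩
    ι 1                 ≡⟨ /-*-cancel 1 n ⟨
    1/suc n * ι (suc n) ∎)

  1/suc-small : ∀ {ε} → 0ℚ < ε → ∃[ N ] ∀ n → N ℕ.≤ n → 1/suc n < ε
  1/suc-small {ε} 0<ε = N , λ n N≤n → *-cancelʳ-< (ι (suc n)) (0≤ι (suc n)) (begin-strict
    1/suc n * ι (suc n) ≡⟨ /-*-cancel 1 n ⟩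
    ι 1                 <⟨ proj₂ (ε-archimedean (ι 1) 0<ε) ⟩
    ε * ι N             ≤⟨ *-monoˡ (ℚ.<⇒≤ 0<ε) (ι-mono-≤ (ℕ.m≤n⇒m≤1+n N≤n)) ⟩
    ε * ι (suc n)       ∎)
    where
    N : ℕ
    N = proj₁ (ε-archimedean (ι 1) 0<ε)

  ∑ℚ : (ℕ → ℚ) → ℕ → ℚ
  ∑ℚ f zero    = 0ℚ
  ∑ℚ f (suc n) = ∑ℚ f n + f n

  open SemiringDefs ℚ.+-*-rawSemiring using () renaming (_^_ to _^ℚ_) public

  invFact : ℕ → ℚ
  invFact k = (+ 1 ℚ./ (k !)) {{k ℕ.!≢0}}

  expTermℚ : ℚ → ℕ → ℚ
  expTermℚ p k = p ^ℚ k * invFact k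

  /-*-cancel′ : ∀ a d .{{_ : ℕ.NonZero d}} → (+ a ℚ./ d) * ι d ≡ ι a
  /-*-cancel′ a (suc d) = /-*-cancel a d

  invFact-inverse : ∀ k → invFact k * ι (k !) ≡ 1ℚ
  invFact-inverse k = /-*-cancel′ 1 (k !) {{k ℕ.!≢0}}

  0<ι! : ∀ k → 0ℚ < ι (k !)
  0<ι! k = ι-mono-< (ℕ.>-nonZero⁻¹ (k !) {{k ℕ.!≢0}})

  invFact-pos : ∀ k → 0ℚ < invFact k
  invFact-pos k = *-cancelʳ-< (ι (k !)) (ℚ.<⇒≤ (0<ι! k)) (begin-strict
    0ℚ * ι (k !)      ≡⟨ ℚ.*-zeroˡ (ι (k !)) ⟩
    0ℚ                <⟨ 0<ι 0 ⟩
    1ℚ                ≡⟨ invFact-inverse k ⟨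
    invFact k * ι (k !)  ∎)

  invFact-suc : ∀ k → invFact (suc k) * ι (suc k) ≡ invFact k
  invFact-suc k = ℚ.≤-antisym
    (*-cancelʳ-≤ (ι (k !)) (0<ι! k) (ℚ.≤-reflexive eq))
    (*-cancelʳ-≤ (ι (k !)) (0<ι! k) (ℚ.≤-reflexive (sym eq)))
    where
    eq : invFact (suc k) * ι (suc k) * ι (k !) ≡ invFact k * ι (k !)
    eq = begin-equality
      invFact (suc k) * ι (suc k) * ι (k !)   ≡⟨ ℚ.*-assoc (invFact (suc k)) (ι (suc k)) (ι (k !)) ⟩
      invFact (suc k) * (ι (suc k) * ι (k !)) ≡⟨ cong (invFact (suc k) *_) (ι-* (suc k) (k !)) ⟨
      invFact (suc k) * ι (suc k !)           ≡⟨ invFact-inverse (suc k) ⟩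
      1ℚ                                 ≡⟨ invFact-inverse k ⟨
      invFact k * ι (k !)                   ∎

  expTermℚ-suc : ∀ p k → expTermℚ p (suc k) * ι (suc k) ≡ expTermℚ p k * p
  expTermℚ-suc p k = begin-equality
    p * p ^ℚ k * invFact (suc k) * ι (suc k)   ≡⟨ ℚ.*-assoc (p * p ^ℚ k) (invFact (suc k)) (ι (suc k)) ⟩
    p * p ^ℚ k * (invFact (suc k) * ι (suc k)) ≡⟨ cong (p * p ^ℚ k *_) (invFact-suc k) ⟩
    p * p ^ℚ k * invFact k                   ≡⟨ solve 3 (λ a b c → a :* b :* c := b :* c :* a) refl p (p ^ℚ k) (invFact k) ⟩
    p ^ℚ k * invFact k * p                   ∎

  ∣^∣≤^ : ∀ {p b} → ∣ p ∣ ≤ b → ∀ k → ∣ p ^ℚ k ∣ ≤ b ^ℚ k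
  ∣^∣≤^ _ zero = ℚ.≤-refl
  ∣^∣≤^ {p} {b} p≤b (suc k) = begin
    ∣ p * p ^ℚ k ∣     ≡⟨ ℚ.∣p*q∣≡∣p∣*∣q∣ p (p ^ℚ k) ⟩
    ∣ p ∣ * ∣ p ^ℚ k ∣ ≤⟨ *-mono (ℚ.≤-trans (ℚ.0≤∣p∣ p) p≤b) (ℚ.0≤∣p∣ (p ^ℚ k)) p≤b (∣^∣≤^ {p} p≤b k) ⟩
    b * b ^ℚ k         ∎

  ∣expTermℚ∣≤ : ∀ {p b} → ∣ p ∣ ≤ b → ∀ k → ∣ expTermℚ p k ∣ ≤ expTermℚ b k
  ∣expTermℚ∣≤ {p} {b} p≤b k = begin
    ∣ p ^ℚ k * invFact k ∣     ≡⟨ ℚ.∣p*q∣≡∣p∣*∣q∣ (p ^ℚ k) (invFact k) ⟩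
    ∣ p ^ℚ k ∣ * ∣ invFact k ∣ ≡⟨ cong (∣ p ^ℚ k ∣ *_) (ℚ.0≤p⇒∣p∣≡p (ℚ.<⇒≤ (invFact-pos k))) ⟩
    ∣ p ^ℚ k ∣ * invFact k     ≤⟨ *-monoʳ (ℚ.<⇒≤ (invFact-pos k)) (∣^∣≤^ {p} p≤b k) ⟩
    b ^ℚ k * invFact k         ∎

  module ExpTail (B : ℕ) where

    b : ℚ
    b = ι (suc B)

    t : ℕ → ℚ
    t = expTermℚ b

    N₀ : ℕ
    N₀ = suc B ℕ.+ suc B

    t≥0 : ∀ k → 0ℚ ≤ t k
    t≥0 k = ℚ.≤-trans (ℚ.0≤∣p∣ (t k)) (∣expTermℚ∣≤ {b} (ℚ.≤-reflexive (ℚ.0≤p⇒∣p∣≡p (0≤ι (suc B)))) k)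

    halving : ∀ {k} → N₀ ℕ.≤ suc k → t (suc k) + t (suc k) ≤ t k
    halving {k} N₀≤k = *-cancelʳ-≤ b (0<ι B) (begin
      (t (suc k) + t (suc k)) * b ≡⟨ solve 2 (λ t b → (t :+ t) :* b := t :* (b :+ b)) refl (t (suc k)) b ⟩
      t (suc k) * (b + b)         ≡⟨ cong (t (suc k) *_) (ι-+ (suc B) (suc B)) ⟨
      t (suc k) * ι N₀            ≤⟨ *-monoˡ (t≥0 (suc k)) (ι-mono-≤ N₀≤k) ⟩
      t (suc k) * ι (suc k)       ≡⟨ expTermℚ-suc b k ⟩
      t k * b                     ∎)

    decay : ∀ j → t (N₀ ℕ.+ j) * ι (suc j) ≤ t N₀
    decay zero = ℚ.≤-reflexive (trans (ℚ.*-identityʳ _) (cong t (ℕ.+-identityʳ N₀)))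
    decay (suc j) = begin
      t (N₀ ℕ.+ suc j) * ι (2 ℕ.+ j) ≡⟨ cong (λ m → t m * ι (2 ℕ.+ j)) (ℕ.+-suc N₀ j) ⟩
      u * ι (2 ℕ.+ j)                ≤⟨ *-monoˡ (t≥0 (suc (N₀ ℕ.+ j))) (ι-mono-≤ 2+j≤) ⟩
      u * ι (suc j ℕ.+ suc j)        ≡⟨ cong (u *_) (ι-+ (suc j) (suc j)) ⟩
      u * (ι (suc j) + ι (suc j))    ≡⟨ solve 2 (λ u i → u :* (i :+ i) := (u :+ u) :* i) refl u (ι (suc j)) ⟩
      (u + u) * ι (suc j)            ≤⟨ *-monoʳ (0≤ι (suc j)) (halving (ℕ.m≤n⇒m≤1+n (ℕ.m≤m+n N₀ j))) ⟩
      t (N₀ ℕ.+ j) * ι (suc j)       ≤⟨ decay j ⟩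
      t N₀                           ∎
      where
      u : ℚ
      u = t (suc (N₀ ℕ.+ j))
      2+j≤ : 2 ℕ.+ j ℕ.≤ suc j ℕ.+ suc j
      2+j≤ = ℕ.s≤s (ℕ.m≤n+m (suc j) j)

    tail : ∀ {p} → ∣ p ∣ ≤ b → ∀ m j → N₀ ℕ.≤ m →
           ∣ ∑ℚ (expTermℚ p) (j ℕ.+ m) - ∑ℚ (expTermℚ p) m ∣ + (t (j ℕ.+ m) + t (j ℕ.+ m)) ≤ t m + t m
    tail {p} p≤b m zero N₀≤m = ℚ.≤-reflexive (begin-equality
      ∣ s - s ∣ + (t m + t m) ≡⟨ cong (λ z → ∣ z ∣ + (t m + t m)) (ℚ.+-inverseʳ s) ⟩
      0ℚ + (t m + t m)        ≡⟨ ℚ.+-identityˡ _ ⟩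
      t m + t m               ∎)
      where
      s : ℚ
      s = ∑ℚ (expTermℚ p) m
    tail {p} p≤b m (suc j) N₀≤m = begin
      ∣ s′ + a - s ∣ + (t (suc k) + t (suc k))
        ≡⟨ cong (λ z → ∣ z ∣ + (t (suc k) + t (suc k)))
             (solve 3 (λ s′ a s → s′ :+ a :- s := (s′ :- s) :+ a) refl s′ a s) ⟩
      ∣ (s′ - s) + a ∣ + (t (suc k) + t (suc k))
        ≤⟨ ℚ.+-mono-≤ (ℚ.∣p+q∣≤∣p∣+∣q∣ (s′ - s) a) (halving (ℕ.m≤n⇒m≤1+n N₀≤k)) ⟩
      ∣ s′ - s ∣ + ∣ a ∣ + t k
        ≤⟨ ℚ.+-monoˡ-≤ (t k) (ℚ.+-monoʳ-≤ ∣ s′ - s ∣ (∣expTermℚ∣≤ {p} p≤b k)) ⟩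
      ∣ s′ - s ∣ + t k + t k
        ≡⟨ ℚ.+-assoc ∣ s′ - s ∣ (t k) (t k) ⟩
      ∣ s′ - s ∣ + (t k + t k)
        ≤⟨ tail {p} p≤b m j N₀≤m ⟩
      t m + t m ∎
      where
      k : ℕ
      k = j ℕ.+ m
      s s′ a : ℚ
      s = ∑ℚ (expTermℚ p) m
      s′ = ∑ℚ (expTermℚ p) k
      a = expTermℚ p k
      N₀≤k : N₀ ℕ.≤ k
      N₀≤k = ℕ.≤-trans N₀≤m (ℕ.m≤n+m m j)

    close : ∀ {ε} N → N₀ ℕ.≤ N → t N < ε → ∀ {p} → ∣ p ∣ ≤ b → ∀ m → N ℕ.≤ m →
            ∣ ∑ℚ (expTermℚ p) m - ∑ℚ (expTermℚ p) N ∣ < ε + ε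
    close {ε} N N₀≤N tN<ε {p} p≤b m N≤m =
      subst (λ m → ∣ ∑ℚ (expTermℚ p) m - s ∣ < ε + ε) (ℕ.m∸n+n≡m N≤m) (begin-strict
        d                 ≡⟨ ℚ.+-identityʳ d ⟨
        d + 0ℚ            ≤⟨ ℚ.+-monoʳ-≤ d (ℚ.+-mono-≤ (t≥0 m′) (t≥0 m′)) ⟩
        d + (t m′ + t m′) ≤⟨ tail {p} p≤b N (m ℕ.∸ N) N₀≤N ⟩
        t N + t N         <⟨ ℚ.+-mono-< tN<ε tN<ε ⟩
        ε + ε             ∎)
      where
      m′ : ℕ
      m′ = m ℕ.∸ N ℕ.+ N
      s d : ℚ
      s = ∑ℚ (expTermℚ p) N
      d = ∣ ∑ℚ (expTermℚ p) m′ - s ∣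

    small-term : ∀ {ε} → 0ℚ < ε → ∃[ N ] N₀ ℕ.≤ N × t N < ε
    small-term {ε} 0<ε = N₀ ℕ.+ j , ℕ.m≤m+n N₀ j ,
      *-cancelʳ-< (ι (suc j)) (0≤ι (suc j)) (begin-strict
        t (N₀ ℕ.+ j) * ι (suc j) ≤⟨ decay j ⟩
        t N₀                     <⟨ proj₂ (ε-archimedean (t N₀) 0<ε) ⟩
        ε * ι j                  ≤⟨ *-monoˡ (ℚ.<⇒≤ 0<ε) (ι-mono-≤ (ℕ.n≤1+n j)) ⟩
        ε * ι (suc j)            ∎)
      where
      j : ℕ
      j = proj₁ (ε-archimedean (t N₀) 0<ε)

    -- The partial sums of the exponential series form a Cauchy sequence
    -- uniformly on [-b, b].
    uniform : ∀ ε → 0ℚ < ε → ∃[ N ] ∀ m n → N ℕ.≤ m → N ℕ.≤ n → ∀ {p} → ∣ p ∣ ≤ b →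
              ∣ ∑ℚ (expTermℚ p) m - ∑ℚ (expTermℚ p) n ∣ < ε
    uniform ε 0<ε = proj₁ small , pair (proj₁ small) (proj₁ (proj₂ small)) (proj₂ (proj₂ small))
      where
      ε′ : ℚ
      ε′ = third (third ε)

      small : ∃[ N ] N₀ ℕ.≤ N × t N < ε′
      small = small-term {ε′} (third-pos {third ε} (third-pos {ε} 0<ε))

      pair : ∀ N → N₀ ℕ.≤ N → t N < ε′ → ∀ m n → N ℕ.≤ m → N ℕ.≤ n → ∀ {p} → ∣ p ∣ ≤ b →
             ∣ ∑ℚ (expTermℚ p) m - ∑ℚ (expTermℚ p) n ∣ < ε
      pair N N₀≤N tN<ε′ m n N≤m N≤n {p} p≤b = begin-strict
        ∣ s m - s n ∣                     ≤⟨ triangle (s m) (s N) (s n) ⟩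
        ∣ s m - s N ∣ + ∣ s N - s n ∣     ≡⟨ cong (_+_ ∣ s m - s N ∣) (∣-∣-sym (s N) (s n)) ⟩
        ∣ s m - s N ∣ + ∣ s n - s N ∣     <⟨ ℚ.+-mono-< (close {ε′} N N₀≤N tN<ε′ {p} p≤b m N≤m) (close {ε′} N N₀≤N tN<ε′ {p} p≤b n N≤n) ⟩
        (ε′ + ε′) + (ε′ + ε′)             <⟨ ℚ.+-mono-< (two-thirds {third ε} (third-pos 0<ε)) (two-thirds {third ε} (third-pos 0<ε)) ⟩
        third ε + third ε                 <⟨ two-thirds 0<ε ⟩
        ε                                 ∎
        where
        s : ℕ → ℚ
        s = ∑ℚ (expTermℚ p)

  isqrt : ℕ → ℕ
  isqrt zero = 0
  isqrt (suc n) with suc (isqrt n) ℕ.* suc (isqrt n) ℕ.≤? suc n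
  ... | yes _ = suc (isqrt n)
  ... | no  _ = isqrt n

  isqrt-lower : ∀ n → isqrt n ℕ.* isqrt n ℕ.≤ n
  isqrt-lower zero = ℕ.z≤n
  isqrt-lower (suc n) with suc (isqrt n) ℕ.* suc (isqrt n) ℕ.≤? suc n
  ... | yes r²≤n = r²≤n
  ... | no  _    = ℕ.m≤n⇒m≤1+n (isqrt-lower n)

  isqrt-upper : ∀ n → n ℕ.< suc (isqrt n) ℕ.* suc (isqrt n)
  isqrt-upper zero = ℕ.s≤s ℕ.z≤n
  isqrt-upper (suc n) with suc (isqrt n) ℕ.* suc (isqrt n) ℕ.≤? suc n
  ... | yes _    = ℕ.≤-<-trans (isqrt-upper n) (ℕ.*-mono-< (ℕ.n<1+n (suc (isqrt n))) (ℕ.n<1+n (suc (isqrt n))))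
  ... | no  r²≰n = ℕ.≰⇒> r²≰n

  √-seq : ℕ → ℕ → ℚ
  √-seq k n = + isqrt (k ℕ.* (suc n ℕ.* suc n)) ℚ./ suc n

  module _ (k n : ℕ) where
    private
      a : ℕ
      a = isqrt (k ℕ.* (suc n ℕ.* suc n))
      d x q : ℚ
      d = ι (suc n)
      x = √-seq k n
      q = 1/suc n
      0<d² : 0ℚ < d * d
      0<d² = *-pos (0<ι n) (0<ι n)
      kd² : ι (k ℕ.* (suc n ℕ.* suc n)) ≡ ι k * (d * d)
      kd² = trans (ι-* k (suc n ℕ.* suc n)) (cong (ι k *_) (ι-* (suc n) (suc n)))

    √-seq-nonNeg : 0ℚ ≤ x
    √-seq-nonNeg = *-cancelʳ-≤ d (0<ι n) (begin
      0ℚ * d ≡⟨ ℚ.*-zeroˡ d ⟩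
      0ℚ     ≤⟨ 0≤ι a ⟩
      ι a    ≡⟨ /-*-cancel a n ⟨
      x * d  ∎)

    √-seq-lower : x * x ≤ ι k
    √-seq-lower = *-cancelʳ-≤ (d * d) 0<d² (begin
      x * x * (d * d)   ≡⟨ solve 2 (λ x d → x :* x :* (d :* d) := (x :* d) :* (x :* d)) refl x d ⟩
      (x * d) * (x * d) ≡⟨ cong₂ _*_ (/-*-cancel a n) (/-*-cancel a n) ⟩
      ι a * ι a         ≡⟨ ι-* a a ⟨
      ι (a ℕ.* a)       ≤⟨ ι-mono-≤ (isqrt-lower (k ℕ.* (suc n ℕ.* suc n))) ⟩
      ι (k ℕ.* (suc n ℕ.* suc n)) ≡⟨ kd² ⟩
      ι k * (d * d)     ∎)

    √-seq-upper : ι k < (x + q) * (x + q)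
    √-seq-upper = *-cancelʳ-< (d * d) (ℚ.<⇒≤ 0<d²) (begin-strict
      ι k * (d * d)               ≡⟨ kd² ⟨
      ι (k ℕ.* (suc n ℕ.* suc n)) <⟨ ι-mono-< (isqrt-upper (k ℕ.* (suc n ℕ.* suc n))) ⟩
      ι (suc a ℕ.* suc a)         ≡⟨ ι-* (suc a) (suc a) ⟩
      ι (suc a) * ι (suc a)       ≡⟨ cong₂ _*_ eq eq ⟩
      (x * d + q * d) * (x * d + q * d)
        ≡⟨ solve 3 (λ x q d → (x :* d :+ q :* d) :* (x :* d :+ q :* d) :=
                              (x :+ q) :* (x :+ q) :* (d :* d)) refl x q d ⟩
      (x + q) * (x + q) * (d * d) ∎)
      where
      eq : ι (suc a) ≡ x * d + q * d
      eq = trans (cong ι (ℕ.+-comm 1 a)) (trans (ι-+ a 1)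
             (sym (cong₂ _+_ (/-*-cancel a n) (/-*-cancel 1 n))))

  √-seq-< : ∀ k m n → √-seq k m < √-seq k n + 1/suc n
  √-seq-< k m n = square-cancel-<
    (ℚ.+-mono-≤ (√-seq-nonNeg k n) (ℚ.<⇒≤ (1/suc-pos n)))
    (ℚ.≤-<-trans (√-seq-lower k m) (√-seq-upper k n))

IsCauchy : (ℕ → ℚ) → Set
IsCauchy f = ∀ ε → 0ℚ ℚ.< ε →
  ∃[ N ] ∀ m n → N ℕ.≤ m → N ℕ.≤ n → ℚ.∣ f m ℚ.- f n ∣ ℚ.< ε

module CauchyFacts where
  open import Data.Rational.Base using (_+_; _*_; _-_; -_; _≤_; _<_; ∣_∣)
  open ℚ.≤-Reasoning
  open +-*-Solver
  open RationalFacts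

  const-cauchy : ∀ p → IsCauchy (λ _ → p)
  const-cauchy p ε 0<ε = 0 , λ _ _ _ _ → subst (_< ε) (sym (cong ∣_∣ (ℚ.+-inverseʳ p))) 0<ε

  +-cauchy : ∀ {f g} → IsCauchy f → IsCauchy g → IsCauchy (λ n → f n + g n)
  +-cauchy {f} {g} F G ε 0<ε with F (third ε) (third-pos 0<ε) | G (third ε) (third-pos 0<ε)
  ... | M , hf | N , hg = M ℕ.⊔ N , λ m n M≤m M≤n → begin-strict
    ∣ f m + g m - (f n + g n) ∣
      ≡⟨ cong ∣_∣ (solve 4 (λ a b c d → a :+ b :- (c :+ d) := (a :- c) :+ (b :- d)) refl (f m) (g m) (f n) (g n)) ⟩
    ∣ (f m - f n) + (g m - g n) ∣
      ≤⟨ ℚ.∣p+q∣≤∣p∣+∣q∣ (f m - f n) (g m - g n) ⟩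
    ∣ f m - f n ∣ + ∣ g m - g n ∣
      <⟨ ℚ.+-mono-< (hf m n (ℕ.m⊔n≤o⇒m≤o M N M≤m) (ℕ.m⊔n≤o⇒m≤o M N M≤n))
                    (hg m n (ℕ.m⊔n≤o⇒n≤o M N M≤m) (ℕ.m⊔n≤o⇒n≤o M N M≤n)) ⟩
    third ε + third ε
      <⟨ two-thirds 0<ε ⟩
    ε ∎

  neg-cauchy : ∀ {f} → IsCauchy f → IsCauchy (λ n → - f n)
  neg-cauchy {f} F ε 0<ε with F ε 0<ε
  ... | N , h = N , λ m n N≤m N≤n → subst (_< ε)
    (trans (∣-∣-sym (f m) (f n))
      (cong ∣_∣ (solve 2 (λ a b → b :- a := :- a :- :- b) refl (f m) (f n))))
    (h m n N≤m N≤n)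

  abs-cauchy : ∀ {f} → IsCauchy f → IsCauchy (λ n → ∣ f n ∣)
  abs-cauchy {f} F ε 0<ε with F ε 0<ε
  ... | N , h = N , λ m n N≤m N≤n → ∣∣-∣-∣∣-< (f m) (f n) (h m n N≤m N≤n)

  EventuallyBounded : (ℕ → ℚ) → Set
  EventuallyBounded f = ∃[ K ] 0ℚ < K × ∃[ N ] ∀ n → N ℕ.≤ n → ∣ f n ∣ ≤ K

  bounded : ∀ {f} → IsCauchy f → EventuallyBounded f
  bounded {f} F with F 1ℚ (0<ι 0)
  ... | N , h = ∣ f N ∣ + 1ℚ , ℚ.+-mono-≤-< (ℚ.0≤∣p∣ (f N)) (0<ι 0) , N , λ n N≤n →
    ℚ.<⇒≤ (<-+-∣-∣ ∣ f n ∣ (∣∣-∣-∣∣-< (f n) (f N) (h n N N≤n ℕ.≤-refl)))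

  *-cauchy : ∀ {f g} → IsCauchy f → IsCauchy g → IsCauchy (λ n → f n * g n)
  *-cauchy {f} {g} F G ε 0<ε = product (bounded F) (bounded G)
    where
    product : EventuallyBounded f → EventuallyBounded g →
              ∃[ N ] (∀ m n → N ℕ.≤ m → N ℕ.≤ n → ∣ f m * g m - f n * g n ∣ < ε)
    product (K₁ , 0<K₁ , N₁ , f≤K₁) (K₂ , 0<K₂ , N₂ , g≤K₂) = result
      (F (third ε * recip K₂) (*-pos {third ε} {recip K₂} (third-pos 0<ε) (recip-pos 0<K₂)))
      (G (third ε * recip K₁) (*-pos {third ε} {recip K₁} (third-pos 0<ε) (recip-pos 0<K₁)))
      where
      small : ∀ p q {K} → 0ℚ < K → ∣ q ∣ ≤ K → ∣ p ∣ < third ε * recip K → ∣ p * q ∣ < third ε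
      small p q {K} 0<K q≤K p<ε/K = begin-strict
        ∣ p * q ∣               ≡⟨ ℚ.∣p*q∣≡∣p∣*∣q∣ p q ⟩
        ∣ p ∣ * ∣ q ∣           ≤⟨ *-monoˡ (ℚ.0≤∣p∣ p) q≤K ⟩
        ∣ p ∣ * K               <⟨ *-mono-<ʳ 0<K p<ε/K ⟩
        third ε * recip K * K   ≡⟨ ℚ.*-assoc (third ε) (recip K) K ⟩
        third ε * (recip K * K) ≡⟨ cong (third ε *_) (recip-inverse (ℚ.<⇒≢ 0<K ∘ sym)) ⟩
        third ε * 1ℚ            ≡⟨ ℚ.*-identityʳ (third ε) ⟩
        third ε                 ∎

      close : ∀ a b c d → ∣ a ∣ ≤ K₁ → ∣ d ∣ ≤ K₂ →
              ∣ a - c ∣ < third ε * recip K₂ → ∣ b - d ∣ < third ε * recip K₁ →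
              ∣ a * b - c * d ∣ < ε
      close a b c d a≤K₁ d≤K₂ a-c b-d = begin-strict
        ∣ a * b - c * d ∣
          ≡⟨ cong ∣_∣ (solve 4 (λ a b c d → a :* b :- c :* d := (b :- d) :* a :+ (a :- c) :* d) refl a b c d) ⟩
        ∣ (b - d) * a + (a - c) * d ∣
          ≤⟨ ℚ.∣p+q∣≤∣p∣+∣q∣ ((b - d) * a) ((a - c) * d) ⟩
        ∣ (b - d) * a ∣ + ∣ (a - c) * d ∣
          <⟨ ℚ.+-mono-< (small (b - d) a {K₁} 0<K₁ a≤K₁ b-d) (small (a - c) d {K₂} 0<K₂ d≤K₂ a-c) ⟩
        third ε + third ε
          <⟨ two-thirds 0<ε ⟩
        ε ∎

      result : ∃[ N ] (∀ m n → N ℕ.≤ m → N ℕ.≤ n → ∣ f m - f n ∣ < third ε * recip K₂) →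
               ∃[ N ] (∀ m n → N ℕ.≤ m → N ℕ.≤ n → ∣ g m - g n ∣ < third ε * recip K₁) →
               ∃[ N ] (∀ m n → N ℕ.≤ m → N ℕ.≤ n → ∣ f m * g m - f n * g n ∣ < ε)
      result (N₃ , hf) (N₄ , hg) = (N₁ ℕ.⊔ N₂) ℕ.⊔ (N₃ ℕ.⊔ N₄) , λ m n N≤m N≤n →
        let N₁₂≤m = ℕ.m⊔n≤o⇒m≤o (N₁ ℕ.⊔ N₂) (N₃ ℕ.⊔ N₄) N≤m
            N₃₄≤m = ℕ.m⊔n≤o⇒n≤o (N₁ ℕ.⊔ N₂) (N₃ ℕ.⊔ N₄) N≤m
            N₁₂≤n = ℕ.m⊔n≤o⇒m≤o (N₁ ℕ.⊔ N₂) (N₃ ℕ.⊔ N₄) N≤n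
            N₃₄≤n = ℕ.m⊔n≤o⇒n≤o (N₁ ℕ.⊔ N₂) (N₃ ℕ.⊔ N₄) N≤n
        in close (f m) (g m) (f n) (g n)
             (f≤K₁ m (ℕ.m⊔n≤o⇒m≤o N₁ N₂ N₁₂≤m))
             (g≤K₂ n (ℕ.m⊔n≤o⇒n≤o N₁ N₂ N₁₂≤n))
             (hf m n (ℕ.m⊔n≤o⇒m≤o N₃ N₄ N₃₄≤m) (ℕ.m⊔n≤o⇒m≤o N₃ N₄ N₃₄≤n))
             (hg m n (ℕ.m⊔n≤o⇒n≤o N₃ N₄ N₃₄≤m) (ℕ.m⊔n≤o⇒n≤o N₃ N₄ N₃₄≤n))

  BoundedAway : (ℕ → ℚ) → Set
  BoundedAway f = ∃[ δ ] 0ℚ < δ × ∃[ N ] ∀ n → N ℕ.≤ n → δ ≤ ∣ f n ∣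

  recip-cauchy : ∀ {f} → IsCauchy f → BoundedAway f → IsCauchy (recip ∘ f)
  recip-cauchy {f} F (δ , 0<δ , N₁ , away) ε 0<ε
    with F (ε * (δ * δ)) (*-pos 0<ε (*-pos 0<δ 0<δ))
  ... | N₂ , h = N₁ ℕ.⊔ N₂ , λ m n N≤m N≤n →
    close (f m) (f n) (away m (ℕ.m⊔n≤o⇒m≤o N₁ N₂ N≤m)) (away n (ℕ.m⊔n≤o⇒m≤o N₁ N₂ N≤n))
      (h m n (ℕ.m⊔n≤o⇒n≤o N₁ N₂ N≤m) (ℕ.m⊔n≤o⇒n≤o N₁ N₂ N≤n))
    where
    nonzero : ∀ p → δ ≤ ∣ p ∣ → p ≢ 0ℚ
    nonzero _ δ≤p refl = <⇒≱ 0<δ δ≤p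

    close : ∀ p q → δ ≤ ∣ p ∣ → δ ≤ ∣ q ∣ → ∣ p - q ∣ < ε * (δ * δ) → ∣ recip p - recip q ∣ < ε
    close p q δ≤p δ≤q h = *-cancelʳ-< (δ * δ) (ℚ.<⇒≤ (*-pos 0<δ 0<δ)) (begin-strict
      ∣ u - v ∣ * (δ * δ)         ≤⟨ *-monoˡ (ℚ.0≤∣p∣ (u - v)) (*-mono (ℚ.0≤∣p∣ p) (ℚ.<⇒≤ 0<δ) δ≤p δ≤q) ⟩
      ∣ u - v ∣ * (∣ p ∣ * ∣ q ∣) ≡⟨ cong (∣ u - v ∣ *_) (ℚ.∣p*q∣≡∣p∣*∣q∣ p q) ⟨
      ∣ u - v ∣ * ∣ p * q ∣       ≡⟨ ℚ.∣p*q∣≡∣p∣*∣q∣ (u - v) (p * q) ⟨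
      ∣ (u - v) * (p * q) ∣       ≡⟨ cong ∣_∣ eq ⟩
      ∣ q - p ∣                   ≡⟨ ∣-∣-sym q p ⟩
      ∣ p - q ∣                   <⟨ h ⟩
      ε * (δ * δ)                 ∎)
      where
      u v : ℚ
      u = recip p
      v = recip q
      eq : (u - v) * (p * q) ≡ q - p
      eq = begin-equality
        (u - v) * (p * q)         ≡⟨ solve 4 (λ u v p q → (u :- v) :* (p :* q) := (u :* p) :* q :- (v :* q) :* p) refl u v p q ⟩
        (u * p) * q - (v * q) * p ≡⟨ cong₂ (λ a b → a * q - b * p) (recip-inverse (nonzero p δ≤p)) (recip-inverse (nonzero q δ≤q)) ⟩
        1ℚ * q - 1ℚ * p           ≡⟨ cong₂ _-_ (ℚ.*-identityˡ q) (ℚ.*-identityˡ p) ⟩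
        q - p                     ∎

  √-cauchy : ∀ k → IsCauchy (√-seq k)
  √-cauchy k ε 0<ε = proj₁ small , λ m n N≤m N≤n → ∣-∣-< (lemma m n N≤n) (lemma n m N≤m)
    where
    small : ∃[ N ] ∀ n → N ℕ.≤ n → 1/suc n < ε
    small = 1/suc-small 0<ε
    lemma : ∀ m n → proj₁ small ℕ.≤ n → √-seq k m < √-seq k n + ε
    lemma m n N≤n = ℚ.<-trans (√-seq-< k m n) (ℚ.+-monoʳ-< (√-seq k n) (proj₂ small n N≤n))

infix  4 _≃_ _<_ _#_
infixl 6 _+_ _-_
infixl 7 _*_ _÷_⟨_⟩ _/!_
infix  8 -_

-- Cauchy sequences of rationals, to be compared by _≃_ rather than _≡_.
record ℝ : Set where
  constructor mkℝ
  field
    seq    : ℕ → ℚ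
    cauchy : IsCauchy seq

open ℝ public

_≃_ : ℝ → ℝ → Set
x ≃ y = ∀ ε → 0ℚ ℚ.< ε → ∃[ N ] ∀ n → N ℕ.≤ n → ℚ.∣ seq x n ℚ.- seq y n ∣ ℚ.< ε

_<_ : ℝ → ℝ → Set
x < y = ∃[ δ ] 0ℚ ℚ.< δ × ∃[ N ] ∀ n → N ℕ.≤ n → seq x n ℚ.+ δ ℚ.≤ seq y n

_#_ : ℝ → ℝ → Set
x # y = x < y ⊎ y < x

fromℚ : ℚ → ℝ
fromℚ p = mkℝ (λ _ → p) (CauchyFacts.const-cauchy p)

fromℕ : ℕ → ℝ
fromℕ n = fromℚ (+ n ℚ./ 1)

0ℝ 1ℝ : ℝ
0ℝ = fromℚ 0ℚ
1ℝ = fromℚ 1ℚ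

_+_ : ℝ → ℝ → ℝ
x + y = mkℝ (λ n → seq x n ℚ.+ seq y n) (CauchyFacts.+-cauchy {seq x} {seq y} (cauchy x) (cauchy y))

_*_ : ℝ → ℝ → ℝ
x * y = mkℝ (λ n → seq x n ℚ.* seq y n) (CauchyFacts.*-cauchy {seq x} {seq y} (cauchy x) (cauchy y))

-_ : ℝ → ℝ
- x = mkℝ (λ n → ℚ.- seq x n) (CauchyFacts.neg-cauchy {seq x} (cauchy x))

_-_ : ℝ → ℝ → ℝ
x - y = x + (- y)

∣_∣ : ℝ → ℝ
∣ x ∣ = mkℝ (λ n → ℚ.∣ seq x n ∣) (CauchyFacts.abs-cauchy {seq x} (cauchy x))

#0⇒boundedAway : ∀ x → x # 0ℝ → CauchyFacts.BoundedAway (seq x)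
#0⇒boundedAway x (inj₁ (δ , 0<δ , N , x+δ≤0)) = δ , 0<δ , N , λ n N≤n → begin
  δ                            ≡⟨ solve 2 (λ x d → d := x :+ d :- x) refl (seq x n) δ ⟩
  seq x n ℚ.+ δ ℚ.- seq x n    ≤⟨ ℚ.+-monoˡ-≤ (ℚ.- seq x n) (x+δ≤0 n N≤n) ⟩
  0ℚ ℚ.- seq x n               ≡⟨ ℚ.+-identityˡ _ ⟩
  ℚ.- seq x n                  ≤⟨ RationalFacts.≤-∣∣ (ℚ.- seq x n) ⟩
  ℚ.∣ ℚ.- seq x n ∣            ≡⟨ ℚ.∣-p∣≡∣p∣ (seq x n) ⟩
  ℚ.∣ seq x n ∣                ∎
  where
  open ℚ.≤-Reasoning
  open +-*-Solver using (solve; _:+_; _:-_; _:=_)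
#0⇒boundedAway x (inj₂ (δ , 0<δ , N , 0+δ≤x)) = δ , 0<δ , N , λ n N≤n → begin
  δ             ≡⟨ ℚ.+-identityˡ δ ⟨
  0ℚ ℚ.+ δ      ≤⟨ 0+δ≤x n N≤n ⟩
  seq x n       ≤⟨ RationalFacts.≤-∣∣ (seq x n) ⟩
  ℚ.∣ seq x n ∣ ∎
  where open ℚ.≤-Reasoning

-- recip sends 0 to 0, but since y # 0ℝ this affects only finitely many
-- terms; the sequence of the result does not depend on the proof of y # 0ℝ.
_÷_⟨_⟩ : (x y : ℝ) → y # 0ℝ → ℝ
x ÷ y ⟨ y#0 ⟩ = x * mkℝ (RationalFacts.recip ∘ seq y)
  (CauchyFacts.recip-cauchy {seq y} (cauchy y) (#0⇒boundedAway y y#0))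

ℝ-rawSemiring : RawSemiring 0ℓ 0ℓ
ℝ-rawSemiring = record { _≈_ = _≃_ ; _+_ = _+_ ; _*_ = _*_ ; 0# = 0ℝ ; 1# = 1ℝ }

open SemiringDefs ℝ-rawSemiring public using (_^_)

infix 4 _⟶_ _HasSum_

_⟶_ : (ℕ → ℝ) → ℝ → Set
f ⟶ l = ∀ ε → 0ℚ ℚ.< ε → ∃[ N ] ∀ n → N ℕ.≤ n → ∣ f n - l ∣ < fromℚ ε

IsCauchyℝ : (ℕ → ℝ) → Set
IsCauchyℝ f = ∀ ε → 0ℚ ℚ.< ε →
  ∃[ N ] ∀ m n → N ℕ.≤ m → N ℕ.≤ n → ∣ f m - f n ∣ < fromℚ ε

∑ : (ℕ → ℝ) → ℕ → ℝ
∑ f zero    = 0ℝ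
∑ f (suc n) = ∑ f n + f n

_HasSum_ : (ℕ → ℝ) → ℝ → Set
f HasSum s = ∑ f ⟶ s

complete : ∀ f → IsCauchyℝ f → ∃[ l ] f ⟶ l
complete f F = mkℝ l l-cauchy , converges
  where
  open RationalFacts
  open ℚ.≤-Reasoning

  M : ℕ → ℕ
  M n = proj₁ (cauchy (f n) (1/suc n) (1/suc-pos n))

  l : ℕ → ℚ
  l n = seq (f n) (M n)

  approx : ∀ n i → M n ℕ.≤ i → ℚ.∣ seq (f n) i ℚ.- l n ∣ ℚ.< 1/suc n
  approx n i M≤i = proj₂ (cauchy (f n) (1/suc n) (1/suc-pos n)) i (M n) M≤i ℕ.≤-refl

  l-cauchy : IsCauchy l
  l-cauchy ε 0<ε = N₁ ℕ.⊔ N₂ , λ m n N≤m N≤n →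
    close m n (ℕ.m⊔n≤o⇒n≤o N₁ N₂ N≤m) (ℕ.m⊔n≤o⇒n≤o N₁ N₂ N≤n)
      (proj₂ F-third m n (ℕ.m⊔n≤o⇒m≤o N₁ N₂ N≤m) (ℕ.m⊔n≤o⇒m≤o N₁ N₂ N≤n))
    where
    F-third : ∃[ N ] ∀ m n → N ℕ.≤ m → N ℕ.≤ n → ∣ f m - f n ∣ < fromℚ (third ε)
    F-third = F (third ε) (third-pos 0<ε)
    small : ∃[ N ] ∀ n → N ℕ.≤ n → 1/suc n ℚ.< third ε
    small = 1/suc-small (third-pos 0<ε)
    N₁ N₂ : ℕ
    N₁ = proj₁ F-third
    N₂ = proj₁ small

    close : ∀ m n → N₂ ℕ.≤ m → N₂ ℕ.≤ n → ∣ f m - f n ∣ < fromℚ (third ε) → ℚ.∣ l m ℚ.- l n ∣ ℚ.< ε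
    close m n N₂≤m N₂≤n (δ , 0<δ , N₃ , h) = begin-strict
      ℚ.∣ l m ℚ.- l n ∣
        ≤⟨ triangle (l m) a (l n) ⟩
      ℚ.∣ l m ℚ.- a ∣ ℚ.+ ℚ.∣ a ℚ.- l n ∣
        ≤⟨ ℚ.+-monoʳ-≤ ℚ.∣ l m ℚ.- a ∣ (triangle a b (l n)) ⟩
      ℚ.∣ l m ℚ.- a ∣ ℚ.+ (ℚ.∣ a ℚ.- b ∣ ℚ.+ ℚ.∣ b ℚ.- l n ∣)
        <⟨ ℚ.+-mono-< (subst (ℚ._< third ε) (∣-∣-sym a (l m))
                        (ℚ.<-trans (approx m i Mm≤i) (proj₂ small m N₂≤m)))
             (ℚ.+-mono-<
               (ℚ.<-≤-trans (p<p+δ ℚ.∣ a ℚ.- b ∣) (h i N₃≤i))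
               (ℚ.<-trans (approx n i Mn≤i) (proj₂ small n N₂≤n))) ⟩
      third ε ℚ.+ (third ε ℚ.+ third ε)
        ≡⟨ ℚ.+-assoc (third ε) (third ε) (third ε) ⟨
      third ε ℚ.+ third ε ℚ.+ third ε
        ≡⟨ thirds ε ⟩
      ε ∎
      where
      i : ℕ
      i = N₃ ℕ.⊔ (M m ℕ.⊔ M n)
      a b : ℚ
      a = seq (f m) i
      b = seq (f n) i
      N₃≤i : N₃ ℕ.≤ i
      N₃≤i = ℕ.m≤m⊔n N₃ (M m ℕ.⊔ M n)
      Mm≤i : M m ℕ.≤ i
      Mm≤i = ℕ.≤-trans (ℕ.m≤m⊔n (M m) (M n)) (ℕ.m≤n⊔m N₃ (M m ℕ.⊔ M n))
      Mn≤i : M n ℕ.≤ i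
      Mn≤i = ℕ.≤-trans (ℕ.m≤n⊔m (M m) (M n)) (ℕ.m≤n⊔m N₃ (M m ℕ.⊔ M n))
      p<p+δ : ∀ p → p ℚ.< p ℚ.+ δ
      p<p+δ p = subst (ℚ._< p ℚ.+ δ) (ℚ.+-identityʳ p) (ℚ.+-monoʳ-< p 0<δ)

  converges : f ⟶ mkℝ l l-cauchy
  converges ε 0<ε = N₁ ℕ.⊔ N₂ , λ n N≤n →
    third ε , third-pos 0<ε , N₁ ℕ.⊔ M n , λ i N≤i → begin
      ℚ.∣ seq (f n) i ℚ.- l i ∣ ℚ.+ third ε
        ≤⟨ ℚ.+-monoˡ-≤ (third ε) (triangle (seq (f n) i) (l n) (l i)) ⟩
      ℚ.∣ seq (f n) i ℚ.- l n ∣ ℚ.+ ℚ.∣ l n ℚ.- l i ∣ ℚ.+ third ε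
        ≤⟨ ℚ.+-monoˡ-≤ (third ε) (ℚ.+-mono-≤
             (ℚ.<⇒≤ (ℚ.<-trans (approx n i (ℕ.m⊔n≤o⇒n≤o N₁ (M n) N≤i))
                      (proj₂ small n (ℕ.m⊔n≤o⇒n≤o N₁ N₂ N≤n))))
             (ℚ.<⇒≤ (proj₂ stable n i (ℕ.m⊔n≤o⇒m≤o N₁ N₂ N≤n) (ℕ.m⊔n≤o⇒m≤o N₁ (M n) N≤i)))) ⟩
      third ε ℚ.+ third ε ℚ.+ third ε
        ≡⟨ thirds ε ⟩
      ε ∎
    where
    stable : ∃[ N ] ∀ m n → N ℕ.≤ m → N ℕ.≤ n → ℚ.∣ l m ℚ.- l n ∣ ℚ.< third ε
    stable = l-cauchy (third ε) (third-pos 0<ε)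
    small : ∃[ N ] ∀ n → N ℕ.≤ n → 1/suc n ℚ.< third ε
    small = 1/suc-small (third-pos 0<ε)
    N₁ N₂ : ℕ
    N₁ = proj₁ stable
    N₂ = proj₁ small

_/!_ : ℝ → ℕ → ℝ
x /! k = x * fromℚ ((+ 1 ℚ./ (k !)) {{k ℕ.!≢0}})

expTerm : ℝ → ℕ → ℝ
expTerm x k = x ^ k /! k

seq-^ : ∀ x k i → seq (x ^ k) i ≡ seq x i RationalFacts.^ℚ k
seq-^ x zero    i = refl
seq-^ x (suc k) i = cong (seq x i ℚ.*_) (seq-^ x k i)

seq-∑-expTerm : ∀ x n i → seq (∑ (expTerm x) n) i ≡ RationalFacts.∑ℚ (RationalFacts.expTermℚ (seq x i)) n
seq-∑-expTerm x zero    i = refl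
seq-∑-expTerm x (suc n) i = cong₂ ℚ._+_ (seq-∑-expTerm x n i)
  (cong (ℚ._* RationalFacts.invFact n) (seq-^ x n i))

expTerm-cauchy : ∀ x → IsCauchyℝ (∑ (expTerm x))
expTerm-cauchy x ε 0<ε = proj₁ unif , λ m n N≤m N≤n →
  third ε , third-pos 0<ε , proj₁ (proj₂ (proj₂ bound)) , λ i N₁≤i →
  ℚ.≤-trans
    (ℚ.+-monoˡ-≤ (third ε) (ℚ.≤-trans
      (ℚ.≤-reflexive (cong₂ (λ p q → ℚ.∣ p ℚ.- q ∣) (seq-∑-expTerm x m i) (seq-∑-expTerm x n i)))
      (ℚ.<⇒≤ (proj₂ unif m n N≤m N≤n {seq x i} (x≤b i N₁≤i)))))
    (ℚ.<⇒≤ (two-thirds 0<ε))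
  where
  open RationalFacts
  bound : CauchyFacts.EventuallyBounded (seq x)
  bound = CauchyFacts.bounded {seq x} (cauchy x)
  B : ℕ
  B = proj₁ (archimedean (proj₁ bound))
  x≤b : ∀ i → proj₁ (proj₂ (proj₂ bound)) ℕ.≤ i → ℚ.∣ seq x i ∣ ℚ.≤ ι (suc B)
  x≤b i N₁≤i = ℚ.≤-trans (proj₂ (proj₂ (proj₂ bound)) i N₁≤i)
    (ℚ.<⇒≤ (ℚ.<-≤-trans (proj₂ (archimedean (proj₁ bound))) (ι-mono-≤ (ℕ.n≤1+n B))))
  unif : ∃[ N ] ∀ m n → N ℕ.≤ m → N ℕ.≤ n → ∀ {p} → ℚ.∣ p ∣ ℚ.≤ ι (suc B) →
         ℚ.∣ ∑ℚ (expTermℚ p) m ℚ.- ∑ℚ (expTermℚ p) n ∣ ℚ.< third ε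
  unif = ExpTail.uniform B (third ε) (third-pos 0<ε)

exp : ℝ → ℝ
exp x = proj₁ (complete (∑ (expTerm x)) (expTerm-cauchy x))

exp-hasSum : ∀ x → expTerm x HasSum exp x
exp-hasSum x = proj₂ (complete (∑ (expTerm x)) (expTerm-cauchy x))

-- The n-th rational approximation is the largest multiple of 1/(n+1)
-- whose square is at most k.
√_ : ℕ → ℝ
√ k = mkℝ (RationalFacts.√-seq k) (CauchyFacts.√-cauchy k)

√-nonNegative : ∀ k → ¬ (√ k < 0ℝ)
√-nonNegative k (δ , 0<δ , N , √+δ≤0) =
  RationalFacts.<⇒≱ (ℚ.+-mono-≤-< (RationalFacts.√-seq-nonNeg k N) 0<δ) (√+δ≤0 N ℕ.≤-refl)

√-square : ∀ k → √ k * √ k ≃ fromℕ k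
√-square k ε 0<ε = N , λ n N≤n →
  subst (λ z → ℚ.∣ √-seq k n ℚ.* √-seq k n ℚ.- z ∣ ℚ.< ε) (sym (/1≡ι k))
    (∣-∣-< (above n) (below n N≤n))
  where
  open RationalFacts
  open ℚ.≤-Reasoning
  open +-*-Solver using (solve; _:+_; _:*_; _:=_)

  c : ℚ
  c = ι (suc (suc k ℕ.+ suc k))

  0<c : 0ℚ ℚ.< c
  0<c = 0<ι (suc k ℕ.+ suc k)

  small : ∃[ N ] ∀ n → N ℕ.≤ n → 1/suc n ℚ.< ε ℚ.* recip c
  small = 1/suc-small (*-pos {ε} {recip c} 0<ε (recip-pos {c} 0<c))

  N : ℕ
  N = proj₁ small

  above : ∀ n → √-seq k n ℚ.* √-seq k n ℚ.< ι k ℚ.+ ε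
  above n = begin-strict
    √-seq k n ℚ.* √-seq k n ≤⟨ √-seq-lower k n ⟩
    ι k                     ≡⟨ ℚ.+-identityʳ (ι k) ⟨
    ι k ℚ.+ 0ℚ              <⟨ ℚ.+-monoʳ-< (ι k) 0<ε ⟩
    ι k ℚ.+ ε               ∎

  below : ∀ n → N ℕ.≤ n → ι k ℚ.< √-seq k n ℚ.* √-seq k n ℚ.+ ε
  below n N≤n = begin-strict
    ι k                                <⟨ √-seq-upper k n ⟩
    (x ℚ.+ q) ℚ.* (x ℚ.+ q)            ≡⟨ solve 2 (λ x q → (x :+ q) :* (x :+ q) := x :* x :+ q :* (q :+ (x :+ x))) refl x q ⟩
    x ℚ.* x ℚ.+ q ℚ.* (q ℚ.+ (x ℚ.+ x)) ≤⟨ ℚ.+-monoʳ-≤ (x ℚ.* x) (*-monoˡ (ℚ.<⇒≤ (1/suc-pos n)) q+2x≤c) ⟩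
    x ℚ.* x ℚ.+ q ℚ.* c                <⟨ ℚ.+-monoʳ-< (x ℚ.* x) (*-mono-<ʳ {r = c} 0<c (proj₂ small n N≤n)) ⟩
    x ℚ.* x ℚ.+ ε ℚ.* recip c ℚ.* c    ≡⟨ cong (x ℚ.* x ℚ.+_) (ℚ.*-assoc ε (recip c) c) ⟩
    x ℚ.* x ℚ.+ ε ℚ.* (recip c ℚ.* c)  ≡⟨ cong (λ z → x ℚ.* x ℚ.+ ε ℚ.* z) (recip-inverse (ℚ.<⇒≢ 0<c ∘ sym)) ⟩
    x ℚ.* x ℚ.+ ε ℚ.* 1ℚ               ≡⟨ cong (x ℚ.* x ℚ.+_) (ℚ.*-identityʳ ε) ⟩
    x ℚ.* x ℚ.+ ε                      ∎
    where
    x q : ℚ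
    x = √-seq k n
    q = 1/suc n
    x≤1+k : x ℚ.≤ ι (suc k)
    x≤1+k = ℚ.<⇒≤ (square-cancel-< (0≤ι (suc k)) (begin-strict
      x ℚ.* x                 ≤⟨ √-seq-lower k n ⟩
      ι k                     <⟨ ι-mono-< (ℕ.m≤m+n (suc k) (k ℕ.* suc k)) ⟩
      ι (suc k ℕ.* suc k)     ≡⟨ ι-* (suc k) (suc k) ⟩
      ι (suc k) ℚ.* ι (suc k) ∎))
    q≤1 : q ℚ.≤ ι 1
    q≤1 = begin
      q                 ≡⟨ ℚ.*-identityʳ q ⟨
      q ℚ.* ι 1         ≤⟨ *-monoˡ (ℚ.<⇒≤ (1/suc-pos n)) (ι-mono-≤ (ℕ.s≤s (ℕ.z≤n {n}))) ⟩
      q ℚ.* ι (suc n)   ≡⟨ /-*-cancel 1 n ⟩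
      ι 1               ∎
    q+2x≤c : q ℚ.+ (x ℚ.+ x) ℚ.≤ c
    q+2x≤c = begin
      q ℚ.+ (x ℚ.+ x)                     ≤⟨ ℚ.+-mono-≤ q≤1 (ℚ.+-mono-≤ x≤1+k x≤1+k) ⟩
      ι 1 ℚ.+ (ι (suc k) ℚ.+ ι (suc k))   ≡⟨ cong (ι 1 ℚ.+_) (ι-+ (suc k) (suc k)) ⟨
      ι 1 ℚ.+ ι (suc k ℕ.+ suc k)         ≡⟨ ι-+ 1 (suc k ℕ.+ suc k) ⟨
      c                                   ∎

α β : ℝ
α = (1ℝ + √ 5) * fromℚ ℚ.½
β = (1ℝ - √ 5) * fromℚ ℚ.½

{-# OPTIONS --safe #-}
-- With (k)_j the falling factorial, k^n = Σ_j S(n,j) (k)_j and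
-- Σ_k x^k (k)_j / k! = x^j e^x, so Σ_k x^k k^n / k! = e^x Σ_j S(n,j) x^j.
-- Multiplying by x / e^x, adding the cases x = α and x = β, and using
-- α^m + β^m = L_m gives the theorem. The division is legitimate because the
-- partial sums of the exponential series at α and β are eventually bounded
-- below by a positive constant.
module Submission where

open import Data.Bool.Base using (if_then_else_)
open import Data.Fin.Base using (zero; suc)
open import Data.Fin.Subset using (Subset; inside; outside; Nonempty; _∈_; _∩_)
open import Data.Fin.Subset.Properties using (nonempty?; drop-there; ∩-comm; ∩-idem; p∩q⊆p)
open import Data.List.Base using (List; []; _∷_; _++_; map; length; filter; upTo)
open import Data.List.Properties using (map-∘; map-++; map-cong; upTo-∷ʳ)
open import Data.List.Relation.Binary.Permutation.Propositional using (_↭_; prep; swap; ↭-refl; ↭-trans; ↭-sym; ↭⇒↭ₛ)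
open import Data.List.Relation.Binary.Permutation.Propositional.Properties using (All-resp-↭; Any-resp-↭)
import Data.List.Relation.Binary.Permutation.Setoid.Properties as Permutation
open import Data.List.Relation.Unary.All as All using (All; []; _∷_)
import Data.List.Relation.Unary.All.Properties as All
open import Data.List.Relation.Unary.AllPairs as AllPairs using (AllPairs; []; _∷_)
import Data.List.Relation.Unary.AllPairs.Properties as AllPairs
open import Data.List.Relation.Unary.Any as Any using (Any; here; there)
import Data.List.Relation.Unary.Any.Properties as Any
open import Data.Nat.Base as ℕ using (ℕ; zero; suc)
open import Data.Nat.ListAction using (sum)
open import Data.Nat.ListAction.Properties using (sum-++)
import Data.Nat.Properties as ℕ
open import Data.Nat.Solver using (module +-*-Solver)
open import Data.Product.Base using (∃-syntax; Σ-syntax; _×_; _,_; proj₁; proj₂)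
open import Data.Rational.Base as ℚ using (ℚ; 0ℚ; 1ℚ; ½)
import Data.Rational.Properties as ℚ
open import Data.Rational.Solver using () renaming (module +-*-Solver to ℚ-Solver)
open import Data.Sum.Base using (inj₁; inj₂)
open import Data.Vec.Base as Vec using (here; there)
open import Function.Base using (_∘_)
open import Function.Bundles using (_⇔_; mk⇔)
open import Relation.Binary.PropositionalEquality
open import Relation.Nullary using (¬_; ¬?; yes; no; Dec; does; contradiction)
open import Relation.Nullary.Decidable using (does-⇔; dec-true; dec-false; from-yes)
open import Relation.Unary using (_⊆_)

open import Defs using (subsets; choose; Disjoint; IsPartition; isPartition?; stirling₂)

-- Stirling numbers of the second kind

-- `stirling₂` counts an explicit enumeration of families of subsets, so the recurrence for S(n,j)
-- has to be extracted from sums over `choose`. This is done with 0/1-valued weights that are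
-- invariant under permutation, because `choose` fixes an order of the blocks that deleting an
-- element does not respect. The series in `k` need no convergence test of their own: each is a
-- finite linear combination of series that arise from the exponential series by multiplying by `x`
-- and shifting the index. Most identities between reals hold exactly for each rational
-- approximation. Apart from limits of series, this fails at two places only: the square of `√ 5`
-- equals 5 only in the limit, and `recip` inverts the approximations of the exponential only from
-- some index on. A lower bound for the exponential at β needs care because β is negative and its
-- series alternates; the quadratic Taylor polynomial is at least 1/2 and dominates the tail.

module Summation where
  open import Data.Nat.Base using (_+_; _*_)
  open ≡-Reasoning
  open +-*-Solver

  infixr 5 ∑∈
  ∑∈ : ∀ {A : Set} → List A → (A → ℕ) → ℕ
  ∑∈ xs f = sum (map f xs)

  syntax ∑∈ xs (λ x → e) = ∑[ x ∈ xs ] e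

  ∑∈-cong : ∀ {A : Set} {f g : A → ℕ} → f ≗ g → ∀ xs → ∑∈ xs f ≡ ∑∈ xs g
  ∑∈-cong f≗g xs = cong sum (map-cong f≗g xs)

  ∑∈-++ : ∀ {A : Set} (f : A → ℕ) xs ys → ∑∈ (xs ++ ys) f ≡ ∑∈ xs f + ∑∈ ys f
  ∑∈-++ f xs ys = trans (cong sum (map-++ f xs ys)) (sum-++ (map f xs) (map f ys))

  ∑∈-map : ∀ {A B : Set} (g : A → B) (f : B → ℕ) xs → ∑∈ (map g xs) f ≡ ∑∈ xs (f ∘ g)
  ∑∈-map g f xs = cong sum (sym (map-∘ xs))

  ∑∈-+ : ∀ {A : Set} (f g : A → ℕ) xs → ∑[ x ∈ xs ] (f x + g x) ≡ ∑∈ xs f + ∑∈ xs g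
  ∑∈-+ f g []       = refl
  ∑∈-+ f g (x ∷ xs) = trans (cong (f x + g x +_) (∑∈-+ f g xs))
    (solve 4 (λ a b c d → a :+ b :+ (c :+ d) := a :+ c :+ (b :+ d)) refl (f x) (g x) (∑∈ xs f) (∑∈ xs g))

  ∑∈-*ˡ : ∀ {A : Set} c (f : A → ℕ) xs → ∑[ x ∈ xs ] (c * f x) ≡ c * ∑∈ xs f
  ∑∈-*ˡ c f []       = sym (ℕ.*-zeroʳ c)
  ∑∈-*ˡ c f (x ∷ xs) = trans (cong (c * f x +_) (∑∈-*ˡ c f xs)) (sym (ℕ.*-distribˡ-+ c (f x) (∑∈ xs f)))

  ∑∈-*ʳ : ∀ {A : Set} c (f : A → ℕ) xs → ∑[ x ∈ xs ] (f x * c) ≡ ∑∈ xs f * c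
  ∑∈-*ʳ c f xs = trans (∑∈-cong (λ x → ℕ.*-comm (f x) c) xs)
    (trans (∑∈-*ˡ c f xs) (ℕ.*-comm c (∑∈ xs f)))

  ∑∈-zero : ∀ {A : Set} {f : A → ℕ} → (∀ x → f x ≡ 0) → ∀ xs → ∑∈ xs f ≡ 0
  ∑∈-zero f≡0 []       = refl
  ∑∈-zero f≡0 (x ∷ xs) = cong₂ _+_ (f≡0 x) (∑∈-zero f≡0 xs)

  ∑∈-upTo-suc : ∀ (f : ℕ → ℕ) m → ∑∈ (upTo (suc m)) f ≡ ∑∈ (upTo m) f + f m
  ∑∈-upTo-suc f m = begin
    ∑∈ (upTo (suc m)) f         ≡⟨ cong (λ xs → ∑∈ xs f) (upTo-∷ʳ m) ⟨
    ∑∈ (upTo m ++ m ∷ []) f     ≡⟨ ∑∈-++ f (upTo m) (m ∷ []) ⟩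
    ∑∈ (upTo m) f + (f m + 0)   ≡⟨ cong (∑∈ (upTo m) f +_) (ℕ.+-identityʳ (f m)) ⟩
    ∑∈ (upTo m) f + f m         ∎

  -- Sums over all selections of k entries of a list

  ∑choose-∷ : ∀ {A : Set} k (x : A) xs f →
    ∑∈ (choose (suc k) (x ∷ xs)) f ≡ ∑∈ (choose k xs) (f ∘ (x ∷_)) + ∑∈ (choose (suc k) xs) f
  ∑choose-∷ k x xs f = trans (∑∈-++ f (map (x ∷_) (choose k xs)) (choose (suc k) xs))
    (cong (_+ ∑∈ (choose (suc k) xs) f) (∑∈-map (x ∷_) f (choose k xs)))

  ∑choose-map : ∀ {A B : Set} (g : A → B) k xs f →
    ∑∈ (choose k (map g xs)) f ≡ ∑∈ (choose k xs) (f ∘ map g)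
  ∑choose-map g zero    xs       f = refl
  ∑choose-map g (suc k) []       f = refl
  ∑choose-map g (suc k) (x ∷ xs) f = begin
    ∑∈ (choose (suc k) (g x ∷ map g xs)) f
      ≡⟨ ∑choose-∷ k (g x) (map g xs) f ⟩
    ∑∈ (choose k (map g xs)) (f ∘ (g x ∷_)) + ∑∈ (choose (suc k) (map g xs)) f
      ≡⟨ cong₂ _+_ (∑choose-map g k xs (f ∘ (g x ∷_))) (∑choose-map g (suc k) xs f) ⟩
    ∑∈ (choose k xs) (f ∘ map g ∘ (x ∷_)) + ∑∈ (choose (suc k) xs) (f ∘ map g)
      ≡⟨ ∑choose-∷ k x xs (f ∘ map g) ⟨
    ∑∈ (choose (suc k) (x ∷ xs)) (f ∘ map g) ∎

  Symmetric : ∀ {A : Set} → (List A → ℕ) → Set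
  Symmetric f = ∀ {xs ys} → xs ↭ ys → f xs ≡ f ys

  -- A selection on which `f` does not vanish uses at most one entry of `map g bs`, and symmetry
  -- brings that entry to the front. The induction on `xs` replaces `f` by `f ∘ (x ∷_)`, hence an
  -- arbitrary symmetric `f`. With `g` = `in′` this expresses that at most one block contains `0`.
  ∑choose-atMostOne : ∀ {A B : Set} (g : B → A) f → Symmetric f →
    (∀ b b′ xs → f (g b ∷ g b′ ∷ xs) ≡ 0) → ∀ k xs bs →
    ∑∈ (choose (suc k) (xs ++ map g bs)) f ≡
    ∑∈ (choose (suc k) xs) f + (∑[ b ∈ bs ] ∑∈ (choose k xs) (f ∘ (g b ∷_)))
  ∑choose-atMostOne g f f-sym f≡0 k [] [] = refl
  ∑choose-atMostOne g f f-sym f≡0 k [] (b ∷ bs) = trans (∑choose-∷ k (g b) (map g bs) f)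
    (cong₂ _+_ (only k) (∑choose-atMostOne g f f-sym f≡0 k [] bs))
    where
    only : ∀ k → ∑∈ (choose k (map g bs)) (f ∘ (g b ∷_)) ≡ ∑∈ (choose k []) (f ∘ (g b ∷_))
    only zero    = refl
    only (suc k) = vanish k bs
      where
      vanish : ∀ k bs → ∑∈ (choose (suc k) (map g bs)) (f ∘ (g b ∷_)) ≡ 0
      vanish k []        = refl
      vanish k (b′ ∷ bs) = trans (∑choose-∷ k (g b′) (map g bs) (f ∘ (g b ∷_)))
        (cong₂ _+_ (∑∈-zero (f≡0 b b′) (choose k (map g bs))) (vanish k bs))
  ∑choose-atMostOne g f f-sym f≡0 zero (x ∷ xs) bs = begin
    ∑∈ (choose 1 (x ∷ xs ++ map g bs)) f
      ≡⟨ ∑choose-∷ 0 x (xs ++ map g bs) f ⟩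
    fx + ∑∈ (choose 1 (xs ++ map g bs)) f
      ≡⟨ cong (fx +_) (∑choose-atMostOne g f f-sym f≡0 0 xs bs) ⟩
    fx + (∑∈ (choose 1 xs) f + r)
      ≡⟨ ℕ.+-assoc fx (∑∈ (choose 1 xs) f) r ⟨
    fx + ∑∈ (choose 1 xs) f + r
      ≡⟨ cong (_+ r) (∑choose-∷ 0 x xs f) ⟨
    ∑∈ (choose 1 (x ∷ xs)) f + r ∎
    where
    fx r : ℕ
    fx = f (x ∷ []) + 0
    r = ∑[ b ∈ bs ] (f (g b ∷ []) + 0)
  ∑choose-atMostOne g f f-sym f≡0 (suc k) (x ∷ xs) bs = begin
    ∑∈ (choose (2 + k) (x ∷ xs ++ map g bs)) f
      ≡⟨ ∑choose-∷ (suc k) x (xs ++ map g bs) f ⟩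
    ∑∈ (choose (suc k) (xs ++ map g bs)) (f ∘ (x ∷_)) + ∑∈ (choose (2 + k) (xs ++ map g bs)) f
      ≡⟨ cong₂ _+_
           (∑choose-atMostOne g (f ∘ (x ∷_)) (f-sym ∘ prep x)
             -- The vanishing condition for `f ∘ (x ∷_)`: `x` is carried past both `g b` and `g b′`.
             (λ b b′ ys → trans (f-sym (↭-trans (swap x (g b) ↭-refl) (prep (g b) (swap x (g b′) ↭-refl))))
                                (f≡0 b b′ (x ∷ ys)))
             k xs bs)
           (∑choose-atMostOne g f f-sym f≡0 (suc k) xs bs) ⟩
    (p + q) + (r + s)
      ≡⟨ solve 4 (λ p q r s → (p :+ q) :+ (r :+ s) := (p :+ r) :+ (q :+ s)) refl p q r s ⟩
    (p + r) + (q + s)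
      ≡⟨ cong₂ _+_ (∑choose-∷ (suc k) x xs f) (∑∈-+ _ _ bs) ⟨
    ∑∈ (choose (2 + k) (x ∷ xs)) f +
      (∑[ b ∈ bs ] (∑∈ (choose k xs) (f ∘ (x ∷_) ∘ (g b ∷_)) + ∑∈ (choose (suc k) xs) (f ∘ (g b ∷_))))
      ≡⟨ cong (∑∈ (choose (2 + k) (x ∷ xs)) f +_) (∑∈-cong (λ b → trans
           (cong (_+ ∑∈ (choose (suc k) xs) (f ∘ (g b ∷_)))
             (∑∈-cong (λ ys → f-sym (swap x (g b) ↭-refl)) (choose k xs)))
           (sym (∑choose-∷ k x xs (f ∘ (g b ∷_))))) bs) ⟩
    ∑∈ (choose (2 + k) (x ∷ xs)) f + (∑[ b ∈ bs ] ∑∈ (choose (suc k) (x ∷ xs)) (f ∘ (g b ∷_))) ∎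
    where
    p q r s : ℕ
    p = ∑∈ (choose (suc k) xs) (f ∘ (x ∷_))
    q = ∑[ b ∈ bs ] ∑∈ (choose k xs) (f ∘ (x ∷_) ∘ (g b ∷_))
    r = ∑∈ (choose (2 + k) xs) f
    s = ∑[ b ∈ bs ] ∑∈ (choose (suc k) xs) (f ∘ (g b ∷_))

  -- Double counting: `x` with `k` further entries is a selection of `suc k` entries one of which is
  -- distinguished, in `suc k` possible ways. The inner sum ranges over all of `xs`, so `x` may be
  -- picked twice; such terms vanish by the condition on repetitions.
  ∑choose-distinguished : ∀ {A : Set} f → Symmetric f → (∀ (x : A) xs → f (x ∷ x ∷ xs) ≡ 0) → ∀ k xs →
    (∑[ x ∈ xs ] ∑∈ (choose k xs) (f ∘ (x ∷_))) ≡ suc k * ∑∈ (choose (suc k) xs) f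
  ∑choose-distinguished f f-sym f≡0 k [] = sym (ℕ.*-zeroʳ k)
  ∑choose-distinguished f f-sym f≡0 zero (x ∷ xs) = begin
    fx + (∑[ y ∈ xs ] (f (y ∷ []) + 0)) ≡⟨ cong (fx +_) (∑choose-distinguished f f-sym f≡0 0 xs) ⟩
    fx + 1 * ∑∈ (choose 1 xs) f         ≡⟨ cong (fx +_) (ℕ.*-identityˡ (∑∈ (choose 1 xs) f)) ⟩
    fx + ∑∈ (choose 1 xs) f             ≡⟨ ∑choose-∷ 0 x xs f ⟨
    ∑∈ (choose 1 (x ∷ xs)) f            ≡⟨ ℕ.*-identityˡ _ ⟨
    1 * ∑∈ (choose 1 (x ∷ xs)) f        ∎
    where
    fx : ℕ
    fx = f (x ∷ []) + 0
  ∑choose-distinguished f f-sym f≡0 (suc k) (x ∷ xs) = begin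
    ∑∈ (choose (suc k) (x ∷ xs)) (f ∘ (x ∷_)) + (∑[ y ∈ xs ] ∑∈ (choose (suc k) (x ∷ xs)) (f ∘ (y ∷_)))
      ≡⟨ cong₂ _+_
           (trans (∑choose-∷ k x xs (f ∘ (x ∷_)))
             (cong (_+ p) (∑∈-zero (f≡0 x) (choose k xs))))
           (trans (∑∈-cong (λ y → trans (∑choose-∷ k x xs (f ∘ (y ∷_)))
                     (cong (_+ ∑∈ (choose (suc k) xs) (f ∘ (y ∷_)))
                       (∑∈-cong (λ ys → f-sym (swap y x ↭-refl)) (choose k xs)))) xs)
             (∑∈-+ _ _ xs)) ⟩
    p + ((∑[ y ∈ xs ] ∑∈ (choose k xs) (f ∘ (x ∷_) ∘ (y ∷_))) +
         (∑[ y ∈ xs ] ∑∈ (choose (suc k) xs) (f ∘ (y ∷_))))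
      ≡⟨ cong (p +_) (cong₂ _+_
           (∑choose-distinguished (f ∘ (x ∷_)) (f-sym ∘ prep x)
             (λ y ys → trans (f-sym (↭-trans (swap x y ↭-refl) (prep y (swap x y ↭-refl)))) (f≡0 y (x ∷ ys)))
             k xs)
           (∑choose-distinguished f f-sym f≡0 (suc k) xs)) ⟩
    p + (suc k * p + (2 + k) * q)
      ≡⟨ solve 3 (λ k p q → p :+ ((con 1 :+ k) :* p :+ (con 2 :+ k) :* q) := (con 2 :+ k) :* (p :+ q)) refl k p q ⟩
    (2 + k) * (p + q)
      ≡⟨ cong ((2 + k) *_) (∑choose-∷ (suc k) x xs f) ⟨
    (2 + k) * ∑∈ (choose (2 + k) (x ∷ xs)) f ∎
    where
    p q : ℕ
    p = ∑∈ (choose (suc k) xs) (f ∘ (x ∷_))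
    q = ∑∈ (choose (2 + k) xs) f

-- Set partitions and the Stirling recurrence

module Stirling where
  open import Data.Nat.Base using (_+_; _*_; _^_)
  open ≡-Reasoning
  open Summation

  [_]? : ∀ {P : Set} → Dec P → ℕ
  [ P? ]? = if does P? then 1 else 0

  []?-cong : ∀ {P Q : Set} (P? : Dec P) (Q? : Dec Q) → P ⇔ Q → [ P? ]? ≡ [ Q? ]?
  []?-cong P? Q? P⇔Q = cong (if_then 1 else 0) (does-⇔ P⇔Q P? Q?)

  []?-false : ∀ {P : Set} (P? : Dec P) → ¬ P → [ P? ]? ≡ 0
  []?-false P? ¬P = cong (if_then 1 else 0) (dec-false P? ¬P)

  length-filter : ∀ {A : Set} {P : A → Set} (P? : ∀ x → Dec (P x)) xs →
    length (filter P? xs) ≡ ∑[ x ∈ xs ] [ P? x ]?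
  length-filter P? [] = refl
  length-filter P? (x ∷ xs) with P? x
  ... | yes _ = cong suc (length-filter P? xs)
  ... | no  _ = length-filter P? xs

  []?-true : ∀ {P : Set} (P? : Dec P) → P → [ P? ]? ≡ 1
  []?-true P? P = cong (if_then 1 else 0) (dec-true P? P)

  partition : ∀ {n} → List (Subset n) → ℕ
  partition bs = [ isPartition? bs ]?

  stirling₂-∑ : ∀ n k → stirling₂ n k ≡ ∑∈ (choose k (subsets n)) partition
  stirling₂-∑ n k = length-filter isPartition? (choose k (subsets n))

  disjoint-sym : ∀ {n} {p q : Subset n} → Disjoint p q → Disjoint q p
  disjoint-sym {p = p} {q} = subst (¬_ ∘ Nonempty) (∩-comm p q)

  IsPartition-resp-↭ : ∀ {n} {as bs : List (Subset n)} → as ↭ bs → IsPartition as → IsPartition bs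
  IsPartition-resp-↭ {n} as↭bs (nonempty , disjoint , cover) =
    All-resp-↭ as↭bs nonempty ,
    Permutation.AllPairs-resp-↭ (setoid (Subset n)) (λ {p} {q} → disjoint-sym {p = p} {q})
      (resp₂ Disjoint) (↭⇒↭ₛ as↭bs) disjoint ,
    λ x → Any-resp-↭ as↭bs (cover x)

  partition-sym : ∀ {n} → Symmetric (partition {n})
  partition-sym {_} {as} {bs} as↭bs = []?-cong (isPartition? as) (isPartition? bs)
    (mk⇔ (IsPartition-resp-↭ as↭bs) (IsPartition-resp-↭ (↭-sym as↭bs)))

  partition-∷∷ : ∀ {n} (b b′ : Subset n) bs → (Nonempty b → ¬ Disjoint b b′) → partition (b ∷ b′ ∷ bs) ≡ 0
  partition-∷∷ b b′ bs meet = []?-false (isPartition? (b ∷ b′ ∷ bs))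
    λ { (b≢∅ ∷ _ , (b∩b′≡∅ ∷ _) ∷ _ , _) → meet b≢∅ b∩b′≡∅ }

  out in′ : ∀ {n} → Subset n → Subset (suc n)
  out = outside Vec.∷_
  in′ = inside Vec.∷_

  nonempty-out⁺ : ∀ {n} {p : Subset n} → Nonempty p → Nonempty (out p)
  nonempty-out⁺ (x , x∈p) = suc x , there x∈p

  nonempty-out⁻ : ∀ {n} {p : Subset n} → Nonempty (out p) → Nonempty p
  nonempty-out⁻ (suc x , there x∈p) = x , x∈p

  disjoint-out⁺ : ∀ {n} {p q : Subset n} → Disjoint p q → Disjoint (out p) (out q)
  disjoint-out⁺ p∩q≡∅ = p∩q≡∅ ∘ nonempty-out⁻

  disjoint-out⁻ : ∀ {n} {p q : Subset n} → Disjoint (out p) (out q) → Disjoint p q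
  disjoint-out⁻ p∩q≡∅ = p∩q≡∅ ∘ nonempty-out⁺

  cover-out⁻ : ∀ {n} {bs : List (Subset n)} {x} → Any (suc x ∈_) (map out bs) → Any (x ∈_) bs
  cover-out⁻ = Any.map drop-there ∘ Any.map⁻

  cover-out⁺ : ∀ {n} {bs : List (Subset n)} {x} → Any (x ∈_) bs → Any (suc x ∈_) (map out bs)
  cover-out⁺ = Any.map⁺ ∘ Any.map there

  zero∉out : ∀ {n} {bs : List (Subset n)} → ¬ Any (zero ∈_) (map out bs)
  zero∉out {bs = _ ∷ _} (there h) = zero∉out h

  partition-in∷out-nonempty : ∀ {n} {b : Subset n} → Nonempty b → ∀ bs →
    IsPartition (in′ b ∷ map out bs) ⇔ IsPartition (b ∷ bs)
  partition-in∷out-nonempty {b = b} b≢∅ bs = mk⇔ to from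
    where
    to : IsPartition (in′ b ∷ map out bs) → IsPartition (b ∷ bs)
    to (_ ∷ nonempty , b∩ ∷ disjoint , cover) =
      b≢∅ ∷ All.gmap⁻ nonempty-out⁻ nonempty ,
      -- `in′ b ∩ out q` and `out b ∩ out q` reduce to the same subset `out (b ∩ q)`, so the lemma
      -- about two `out` sets applies.
      All.gmap⁻ (λ {q} → disjoint-out⁻ {p = b} {q}) b∩ ∷
        AllPairs.map (λ {p} {q} → disjoint-out⁻ {p = p} {q}) (AllPairs.map⁻ disjoint) ,
      λ x → uncons (cover (suc x))
      where
      uncons : ∀ {x} → Any (suc x ∈_) (in′ b ∷ map out bs) → Any (x ∈_) (b ∷ bs)
      uncons (here (there x∈b)) = here x∈b
      uncons (there h)          = there (cover-out⁻ h)
    from : IsPartition (b ∷ bs) → IsPartition (in′ b ∷ map out bs)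
    from (_ ∷ nonempty , b∩ ∷ disjoint , cover) =
      (zero , here) ∷ All.gmap⁺ nonempty-out⁺ nonempty ,
      All.gmap⁺ (λ {q} → disjoint-out⁺ {p = b} {q}) b∩ ∷
        AllPairs.map⁺ (AllPairs.map (λ {p} {q} → disjoint-out⁺ {p = p} {q}) disjoint) ,
      λ { zero → here here ; (suc x) → cons (cover x) }
      where
      cons : ∀ {x} → Any (x ∈_) (b ∷ bs) → Any (suc x ∈_) (in′ b ∷ map out bs)
      cons (here x∈b) = here (there x∈b)
      cons (there h)  = there (cover-out⁺ h)

  -- Here `in′ b` is the singleton block of `0`, which disappears altogether when `0` is deleted.
  partition-in∷out-empty : ∀ {n} {b : Subset n} → ¬ Nonempty b → ∀ bs →
    IsPartition (in′ b ∷ map out bs) ⇔ IsPartition bs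
  partition-in∷out-empty {b = b} b≡∅ bs = mk⇔ to from
    where
    to : IsPartition (in′ b ∷ map out bs) → IsPartition bs
    to (_ ∷ nonempty , _ ∷ disjoint , cover) =
      All.gmap⁻ nonempty-out⁻ nonempty ,
      AllPairs.map (λ {p} {q} → disjoint-out⁻ {p = p} {q}) (AllPairs.map⁻ disjoint) ,
      λ x → uncons (cover (suc x))
      where
      uncons : ∀ {x} → Any (suc x ∈_) (in′ b ∷ map out bs) → Any (x ∈_) bs
      uncons (here (there x∈b)) = contradiction (_ , x∈b) b≡∅
      uncons (there h)          = cover-out⁻ h
    from : IsPartition bs → IsPartition (in′ b ∷ map out bs)
    from (nonempty , disjoint , cover) =
      (zero , here) ∷ All.gmap⁺ nonempty-out⁺ nonempty ,
      All.map⁺ (All.universal (λ q h → b≡∅ (shrink q (nonempty-out⁻ h))) bs) ∷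
        AllPairs.map⁺ (AllPairs.map (λ {p} {q} → disjoint-out⁺ {p = p} {q}) disjoint) ,
      λ { zero → here here ; (suc x) → there (cover-out⁺ (cover x)) }
      where
      shrink : ∀ q → Nonempty (b ∩ q) → Nonempty b
      shrink q (x , x∈b∩q) = x , p∩q⊆p b q x∈b∩q

  empty : ∀ {n} → Subset n → ℕ
  empty b = [ ¬? (nonempty? b) ]?

  -- The two cases exclude each other, since `partition (b ∷ bs)` is `0` for empty `b`. Written as
  -- one sum they can be added up over all `b` without a case distinction: the first term counts
  -- partitions with `0` as a singleton, the second those where `0` was joined to the block `b`.
  partition-in∷out : ∀ {n} (b : Subset n) bs →
    partition (in′ b ∷ map out bs) ≡ empty b * partition bs + partition (b ∷ bs)
  partition-in∷out b bs = case (nonempty? b)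
    where
    case : Dec (Nonempty b) →
           partition (in′ b ∷ map out bs) ≡ empty b * partition bs + partition (b ∷ bs)
    case (yes b≢∅) = begin
      partition (in′ b ∷ map out bs)
        ≡⟨ []?-cong (isPartition? (in′ b ∷ map out bs)) (isPartition? (b ∷ bs)) (partition-in∷out-nonempty b≢∅ bs) ⟩
      partition (b ∷ bs)
        ≡⟨ cong (λ e → e * partition bs + partition (b ∷ bs)) ([]?-false (¬? (nonempty? b)) (λ b≡∅ → b≡∅ b≢∅)) ⟨
      empty b * partition bs + partition (b ∷ bs) ∎
    case (no b≡∅) = begin
      partition (in′ b ∷ map out bs)
        ≡⟨ []?-cong (isPartition? (in′ b ∷ map out bs)) (isPartition? bs) (partition-in∷out-empty b≡∅ bs) ⟩
      partition bs
        ≡⟨ solve 1 (λ p → p := con 1 :* p :+ con 0) refl (partition bs) ⟩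
      1 * partition bs + 0
        ≡⟨ cong₂ (λ e p → e * partition bs + p)
             ([]?-true (¬? (nonempty? b)) b≡∅)
             ([]?-false (isPartition? (b ∷ bs)) λ { (b≢∅ ∷ _ , _) → b≡∅ b≢∅ }) ⟨
      empty b * partition bs + partition (b ∷ bs) ∎
      where open +-*-Solver

  -- This is the coefficient `1` of `stirling₂ n k` in the recurrence.
  ∑-empty : ∀ n → ∑∈ (subsets n) empty ≡ 1
  ∑-empty zero    = refl
  ∑-empty (suc n) = begin
    ∑∈ (subsets (suc n)) empty
      ≡⟨ ∑∈-++ empty (map out (subsets n)) (map in′ (subsets n)) ⟩
    ∑∈ (map out (subsets n)) empty + ∑∈ (map in′ (subsets n)) empty
      ≡⟨ cong₂ _+_ (∑∈-map out empty (subsets n)) (∑∈-map in′ empty (subsets n)) ⟩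
    ∑∈ (subsets n) (empty ∘ out) + ∑∈ (subsets n) (empty ∘ in′)
      ≡⟨ cong₂ _+_ (∑∈-cong empty-out (subsets n)) (∑∈-zero empty-in (subsets n)) ⟩
    ∑∈ (subsets n) empty + 0
      ≡⟨ ℕ.+-identityʳ _ ⟩
    ∑∈ (subsets n) empty
      ≡⟨ ∑-empty n ⟩
    1 ∎
    where
    empty-out : ∀ (b : Subset n) → empty (out b) ≡ empty b
    empty-out b = []?-cong (¬? (nonempty? (out b))) (¬? (nonempty? b))
      (mk⇔ (_∘ nonempty-out⁺) (_∘ nonempty-out⁻))
    empty-in : ∀ (b : Subset n) → empty (in′ b) ≡ 0
    empty-in b = []?-false (¬? (nonempty? (in′ b))) (λ in≡∅ → in≡∅ (zero , here))

  partition-out : ∀ {n} (bs : List (Subset n)) → partition (map out bs) ≡ 0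
  partition-out bs = []?-false (isPartition? (map out bs)) λ (_ , _ , cover) → zero∉out (cover zero)

  stirling₂-0-suc : ∀ k → stirling₂ 0 (suc k) ≡ 0
  stirling₂-0-suc zero    = refl
  stirling₂-0-suc (suc k) = refl

  -- The element 0 lies in exactly one block; deleting 0 from that block
  -- leaves the empty set or a distinguished block of a partition of the rest.
  stirling₂-suc-suc : ∀ n k → stirling₂ (suc n) (suc k) ≡ stirling₂ n k + suc k * stirling₂ n (suc k)
  stirling₂-suc-suc n k = begin
    stirling₂ (suc n) (suc k)
      ≡⟨ stirling₂-∑ (suc n) (suc k) ⟩
    ∑∈ (choose (suc k) (map out S ++ map in′ S)) partition
      ≡⟨ ∑choose-atMostOne in′ partition partition-sym
           (λ b b′ bs → partition-∷∷ (in′ b) (in′ b′) bs (λ _ d → d (zero , here)))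
           k (map out S) S ⟩
    ∑∈ (choose (suc k) (map out S)) partition +
      (∑[ b ∈ S ] ∑∈ (choose k (map out S)) (partition ∘ (in′ b ∷_)))
      ≡⟨ cong₂ _+_
           (trans (∑choose-map out (suc k) S partition) (∑∈-zero partition-out (choose (suc k) S)))
           (∑∈-cong split S) ⟩
    (∑[ b ∈ S ] (empty b * ∑∈ (choose k S) partition + ∑∈ (choose k S) (partition ∘ (b ∷_))))
      ≡⟨ ∑∈-+ _ _ S ⟩
    (∑[ b ∈ S ] (empty b * ∑∈ (choose k S) partition)) + (∑[ b ∈ S ] ∑∈ (choose k S) (partition ∘ (b ∷_)))
      ≡⟨ cong₂ _+_
           (trans (∑∈-*ʳ (∑∈ (choose k S) partition) empty S) (cong (_* ∑∈ (choose k S) partition) (∑-empty n)))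
           (∑choose-distinguished partition partition-sym
             (λ b bs → partition-∷∷ b b bs (λ b≢∅ d → d (subst Nonempty (sym (∩-idem b)) b≢∅))) k S) ⟩
    1 * ∑∈ (choose k S) partition + suc k * ∑∈ (choose (suc k) S) partition
      ≡⟨ cong₂ _+_ (trans (ℕ.*-identityˡ _) (sym (stirling₂-∑ n k))) (cong (suc k *_) (sym (stirling₂-∑ n (suc k)))) ⟩
    stirling₂ n k + suc k * stirling₂ n (suc k) ∎
    where
    S : List (Subset n)
    S = subsets n
    split : ∀ b → ∑∈ (choose k (map out S)) (partition ∘ (in′ b ∷_)) ≡
                  empty b * ∑∈ (choose k S) partition + ∑∈ (choose k S) (partition ∘ (b ∷_))
    split b = begin
      ∑∈ (choose k (map out S)) (partition ∘ (in′ b ∷_))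
        ≡⟨ ∑choose-map out k S (partition ∘ (in′ b ∷_)) ⟩
      ∑∈ (choose k S) (partition ∘ (in′ b ∷_) ∘ map out)
        ≡⟨ ∑∈-cong (partition-in∷out b) (choose k S) ⟩
      (∑[ bs ∈ choose k S ] (empty b * partition bs + partition (b ∷ bs)))
        ≡⟨ ∑∈-+ _ _ (choose k S) ⟩
      (∑[ bs ∈ choose k S ] (empty b * partition bs)) + ∑∈ (choose k S) (partition ∘ (b ∷_))
        ≡⟨ cong (_+ ∑∈ (choose k S) (partition ∘ (b ∷_))) (∑∈-*ˡ (empty b) partition (choose k S)) ⟩
      empty b * ∑∈ (choose k S) partition + ∑∈ (choose k S) (partition ∘ (b ∷_)) ∎

  stirling₂-beyond : ∀ {n k} → n ℕ.< k → stirling₂ n k ≡ 0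
  stirling₂-beyond {zero}  {suc k} _ = stirling₂-0-suc k
  stirling₂-beyond {suc n} {suc k} (ℕ.s≤s n<k) = begin
    stirling₂ (suc n) (suc k)                   ≡⟨ stirling₂-suc-suc n k ⟩
    stirling₂ n k + suc k * stirling₂ n (suc k) ≡⟨ cong₂ (λ a b → a + suc k * b) (stirling₂-beyond n<k) (stirling₂-beyond (ℕ.m<n⇒m<1+n n<k)) ⟩
    suc k * 0                                   ≡⟨ ℕ.*-zeroʳ (suc k) ⟩
    0                                           ∎

  -- Powers in terms of falling factorials

  -- The recursion splits off the largest factor, the one that later cancels against the leading
  -- factor of a factorial.
  falling : ℕ → ℕ → ℕ
  falling k       zero    = 1
  falling zero    (suc j) = 0
  falling (suc k) (suc j) = suc k * falling k j

  -- This is `k = (k - j) + j` multiplied by `(k)_j`, where `(k - j) (k)_j = (k)_{j+1}`, stated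
  -- without truncated subtraction.
  *-falling : ∀ k j → k * falling k j ≡ falling k (suc j) + j * falling k j
  *-falling zero    zero    = refl
  *-falling zero    (suc j) = sym (ℕ.*-zeroʳ j)
  *-falling (suc k) zero    = sym (ℕ.+-identityʳ _)
  *-falling (suc k) (suc j) = begin
    suc k * (suc k * falling k j)
      ≡⟨ cong (suc k *_) (begin
           falling k j + k * falling k j                       ≡⟨ cong (falling k j +_) (*-falling k j) ⟩
           falling k j + (falling k (suc j) + j * falling k j) ≡⟨ solve 3 (λ a b c → a :+ (b :+ c) := b :+ (a :+ c)) refl (falling k j) (falling k (suc j)) (j * falling k j) ⟩
           falling k (suc j) + suc j * falling k j             ∎) ⟩
    suc k * (falling k (suc j) + suc j * falling k j)
      ≡⟨ solve 4 (λ k a j b → k :* (a :+ j :* b) := k :* a :+ j :* (k :* b)) refl (suc k) (falling k (suc j)) (suc j) (falling k j) ⟩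
    suc k * falling k (suc j) + suc j * (suc k * falling k j) ∎
    where open +-*-Solver

  ^-stirling₂ : ∀ k n → k ^ n ≡ ∑[ j ∈ upTo (suc n) ] (stirling₂ n j * falling k j)
  ^-stirling₂ k zero    = refl
  ^-stirling₂ k (suc n) = begin
    k * k ^ n
      ≡⟨ cong (k *_) (^-stirling₂ k n) ⟩
    k * (∑[ j ∈ upTo (suc n) ] (S j * f j))
      ≡⟨ ∑∈-*ˡ k _ (upTo (suc n)) ⟨
    (∑[ j ∈ upTo (suc n) ] (k * (S j * f j)))
      ≡⟨ ℕ.+-identityʳ _ ⟨
    (∑[ j ∈ upTo (suc n) ] (k * (S j * f j))) + 0
      ≡⟨ cong ((∑[ j ∈ upTo (suc n) ] (k * (S j * f j))) +_) last≡0 ⟨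
    (∑[ j ∈ upTo (suc n) ] (k * (S j * f j))) + suc n * S (suc n) * f (suc n)
      ≡⟨ telescope (suc n) ⟨
    (∑[ j ∈ upTo (2 + n) ] (stirling₂ (suc n) j * f j)) ∎
    where
    open +-*-Solver
    S f : ℕ → ℕ
    S = stirling₂ n
    f = falling k
    last≡0 : suc n * S (suc n) * f (suc n) ≡ 0
    last≡0 = begin
      suc n * S (suc n) * f (suc n) ≡⟨ cong (λ s → suc n * s * f (suc n)) (stirling₂-beyond (ℕ.n<1+n n)) ⟩
      suc n * 0 * f (suc n)         ≡⟨ cong (_* f (suc n)) (ℕ.*-zeroʳ (suc n)) ⟩
      0                             ∎
    -- By the recurrence, each index `j` of S(n+1,j) contributes `S(n,j-1) (k)_j + j S(n,j) (k)_j`,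
    -- while `k S(n,j) (k)_j` splits by `*-falling` into `S(n,j) (k)_{j+1} + j S(n,j) (k)_j`. The
    -- remainder is the part of the last term whose partner has not yet been summed; for `m = suc n`
    -- it vanishes because S(n,n+1) = 0.
    telescope : ∀ m → (∑[ j ∈ upTo (suc m) ] (stirling₂ (suc n) j * f j)) ≡
                      (∑[ j ∈ upTo m ] (k * (S j * f j))) + m * S m * f m
    -- The empty family does not cover `0`, so `stirling₂ (suc n) 0` computes to `0`.
    telescope zero    = refl
    telescope (suc m) = begin
      (∑[ j ∈ upTo (2 + m) ] (stirling₂ (suc n) j * f j))
        ≡⟨ ∑∈-upTo-suc (λ j → stirling₂ (suc n) j * f j) (suc m) ⟩
      (∑[ j ∈ upTo (suc m) ] (stirling₂ (suc n) j * f j)) + stirling₂ (suc n) (suc m) * f (suc m)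
        ≡⟨ cong₂ _+_ (telescope m) (cong (_* f (suc m)) (stirling₂-suc-suc n m)) ⟩
      (t + m * S m * f m) + (S m + suc m * S (suc m)) * f (suc m)
        ≡⟨ solve 7 (λ t m s f s′ f′ m′ → (t :+ m :* s :* f) :+ (s :+ m′ :* s′) :* f′ :=
                     (t :+ s :* (f′ :+ m :* f)) :+ m′ :* s′ :* f′)
             refl t m (S m) (f m) (S (suc m)) (f (suc m)) (suc m) ⟩
      (t + S m * (f (suc m) + m * f m)) + suc m * S (suc m) * f (suc m)
        ≡⟨ cong (λ z → t + z + suc m * S (suc m) * f (suc m)) (begin
             S m * (f (suc m) + m * f m) ≡⟨ cong (S m *_) (*-falling k m) ⟨
             S m * (k * f m)             ≡⟨ solve 3 (λ s k f → s :* (k :* f) := k :* (s :* f)) refl (S m) k (f m) ⟩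
             k * (S m * f m)             ∎) ⟩
      (t + k * (S m * f m)) + suc m * S (suc m) * f (suc m)
        ≡⟨ cong (_+ suc m * S (suc m) * f (suc m)) (∑∈-upTo-suc _ m) ⟨
      (∑[ j ∈ upTo (suc m) ] (k * (S j * f j))) + suc m * S (suc m) * f (suc m) ∎
      where
      t : ℕ
      t = ∑[ j ∈ upTo m ] (k * (S j * f j))

-- Real sequences and series

open import Data.Integer.Base using (+_)
open import Defs hiding (∣_∣)
open RationalFacts
open ℚ.≤-Reasoning
open ℚ-Solver

Eventually : (ℕ → Set) → Set
Eventually P = ∃[ N ] ∀ n → N ℕ.≤ n → P n

eventually-map : ∀ {P Q : ℕ → Set} → P ⊆ Q → Eventually P → Eventually Q
eventually-map P⊆Q (N , p) = N , λ n N≤n → P⊆Q (p n N≤n)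

eventually-zip : ∀ {P Q R : ℕ → Set} → (∀ {n} → P n → Q n → R n) →
  Eventually P → Eventually Q → Eventually R
eventually-zip f (M , p) (N , q) = M ℕ.⊔ N , λ n M⊔N≤n →
  f (p n (ℕ.m⊔n≤o⇒m≤o M N M⊔N≤n)) (q n (ℕ.m⊔n≤o⇒n≤o M N M⊔N≤n))

Close : ℚ → ℚ → ℚ → Set
Close ε p q = ℚ.∣ p ℚ.- q ∣ ℚ.< ε

close-refl : ∀ {ε p q} → 0ℚ ℚ.< ε → p ≡ q → Close ε p q
close-refl {ε} {p} 0<ε refl = subst (ℚ._< ε) (sym (cong ℚ.∣_∣ (ℚ.+-inverseʳ p))) 0<ε

close-trans : ∀ {ε} p q r → 0ℚ ℚ.< ε → Close (third ε) p q → Close (third ε) q r → Close ε p r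
close-trans {ε} p q r 0<ε p≈q q≈r = begin-strict
  ℚ.∣ p ℚ.- r ∣                   ≤⟨ triangle p q r ⟩
  ℚ.∣ p ℚ.- q ∣ ℚ.+ ℚ.∣ q ℚ.- r ∣ <⟨ ℚ.+-mono-< p≈q q≈r ⟩
  third ε ℚ.+ third ε             <⟨ two-thirds 0<ε ⟩
  ε                               ∎

close-+ : ∀ {ε} p q r s → 0ℚ ℚ.< ε → Close (third ε) p r → Close (third ε) q s →
  Close ε (p ℚ.+ q) (r ℚ.+ s)
close-+ {ε} p q r s 0<ε p≈r q≈s = begin-strict
  ℚ.∣ p ℚ.+ q ℚ.- (r ℚ.+ s) ∣
    ≡⟨ cong ℚ.∣_∣ (solve 4 (λ p q r s → p :+ q :- (r :+ s) := (p :- r) :+ (q :- s)) refl p q r s) ⟩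
  ℚ.∣ (p ℚ.- r) ℚ.+ (q ℚ.- s) ∣
    ≤⟨ ℚ.∣p+q∣≤∣p∣+∣q∣ (p ℚ.- r) (q ℚ.- s) ⟩
  ℚ.∣ p ℚ.- r ∣ ℚ.+ ℚ.∣ q ℚ.- s ∣
    <⟨ ℚ.+-mono-< p≈r q≈s ⟩
  third ε ℚ.+ third ε
    <⟨ two-thirds 0<ε ⟩
  ε ∎

close-* : ∀ {ε K} r p q → 0ℚ ℚ.< K → ℚ.∣ r ∣ ℚ.≤ K → Close (ε ℚ.* recip K) p q →
  Close ε (r ℚ.* p) (r ℚ.* q)
close-* {ε} {K} r p q 0<K r≤K p≈q = begin-strict
  ℚ.∣ r ℚ.* p ℚ.- r ℚ.* q ∣   ≡⟨ cong ℚ.∣_∣ (solve 3 (λ r p q → r :* p :- r :* q := (p :- q) :* r) refl r p q) ⟩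
  ℚ.∣ (p ℚ.- q) ℚ.* r ∣       ≡⟨ ℚ.∣p*q∣≡∣p∣*∣q∣ (p ℚ.- q) r ⟩
  ℚ.∣ p ℚ.- q ∣ ℚ.* ℚ.∣ r ∣   ≤⟨ *-monoˡ (ℚ.0≤∣p∣ (p ℚ.- q)) r≤K ⟩
  ℚ.∣ p ℚ.- q ∣ ℚ.* K         <⟨ *-mono-<ʳ {r = K} 0<K p≈q ⟩
  ε ℚ.* recip K ℚ.* K         ≡⟨ ℚ.*-assoc ε (recip K) K ⟩
  ε ℚ.* (recip K ℚ.* K)       ≡⟨ cong (ε ℚ.*_) (recip-inverse (ℚ.<⇒≢ 0<K ∘ sym)) ⟩
  ε ℚ.* 1ℚ                    ≡⟨ ℚ.*-identityʳ ε ⟩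
  ε                           ∎

infix 4 _≐_

-- Equality of representatives; it implies _≃_ and reduces ring identities
-- in ℝ to ring identities in ℚ.
_≐_ : ℝ → ℝ → Set
x ≐ y = ∀ i → seq x i ≡ seq y i

eventually-≡⇒≃ : ∀ x y → Eventually (λ i → seq x i ≡ seq y i) → x ≃ y
eventually-≡⇒≃ x y x≡y ε 0<ε = eventually-map (λ {i} → close-refl {ε} {seq x i} 0<ε) x≡y

≐⇒≃ : ∀ x y → x ≐ y → x ≃ y
≐⇒≃ x y x≐y = eventually-≡⇒≃ x y (0 , λ i _ → x≐y i)

≃-sym : ∀ x y → x ≃ y → y ≃ x
≃-sym x y x≃y ε 0<ε = eventually-map (λ {i} → subst (ℚ._< ε) (∣-∣-sym (seq x i) (seq y i))) (x≃y ε 0<ε)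

≃-trans : ∀ x y z → x ≃ y → y ≃ z → x ≃ z
≃-trans x y z x≃y y≃z ε 0<ε = eventually-zip
  (λ {i} → close-trans {ε} (seq x i) (seq y i) (seq z i) 0<ε)
  (x≃y (third ε) (third-pos 0<ε)) (y≃z (third ε) (third-pos 0<ε))

+-cong : ∀ x y u v → x ≃ u → y ≃ v → x + y ≃ u + v
+-cong x y u v x≃u y≃v ε 0<ε = eventually-zip
  (λ {i} → close-+ {ε} (seq x i) (seq y i) (seq u i) (seq v i) 0<ε)
  (x≃u (third ε) (third-pos 0<ε)) (y≃v (third ε) (third-pos 0<ε))

-- Multiplication by `x` stretches distances by at most an eventual bound `K` of `x`, so `ε` is
-- divided by `K` first.
*-congˡ : ∀ x y z → y ≃ z → x * y ≃ x * z
*-congˡ x y z y≃z ε 0<ε = scale (CauchyFacts.bounded {seq x} (cauchy x))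
  where
  scale : CauchyFacts.EventuallyBounded (seq x) →
          Eventually λ i → Close ε (seq x i ℚ.* seq y i) (seq x i ℚ.* seq z i)
  scale (K , 0<K , x≤K) = eventually-zip
    (λ {i} → close-* {ε} {K} (seq x i) (seq y i) (seq z i) 0<K) x≤K
    (y≃z (ε ℚ.* recip K) (*-pos {ε} {recip K} 0<ε (recip-pos 0<K)))

seq-∑ : ∀ f n i → seq (∑ f n) i ≡ ∑ℚ (λ k → seq (f k) i) n
seq-∑ f zero    i = refl
seq-∑ f (suc n) i = cong (ℚ._+ seq (f n) i) (seq-∑ f n i)

∑-≐ : ∀ {f g} → (∀ k → f k ≐ g k) → ∀ n → ∑ f n ≐ ∑ g n
∑-≐ f≐g zero    i = refl
∑-≐ f≐g (suc n) i = cong₂ ℚ._+_ (∑-≐ f≐g n i) (f≐g n i)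

∑-≃ : ∀ f g → (∀ k → f k ≃ g k) → ∀ n → ∑ f n ≃ ∑ g n
∑-≃ f g f≃g zero    = ≐⇒≃ 0ℝ 0ℝ (λ _ → refl)
∑-≃ f g f≃g (suc n) = +-cong (∑ f n) (f n) (∑ g n) (g n) (∑-≃ f g f≃g n) (f≃g n)

∑-+ : ∀ f g n → ∑ (λ k → f k + g k) n ≐ ∑ f n + ∑ g n
∑-+ f g zero    i = refl
∑-+ f g (suc n) i = trans (cong (ℚ._+ (seq (f n) i ℚ.+ seq (g n) i)) (∑-+ f g n i))
  (solve 4 (λ a b c d → (a :+ b) :+ (c :+ d) := (a :+ c) :+ (b :+ d)) refl
    (seq (∑ f n) i) (seq (∑ g n) i) (seq (f n) i) (seq (g n) i))

fromℕ-+ : ∀ m n → fromℕ (m ℕ.+ n) ≐ fromℕ m + fromℕ n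
fromℕ-+ m n i = trans (/1≡ι (m ℕ.+ n)) (trans (ι-+ m n) (sym (cong₂ ℚ._+_ (/1≡ι m) (/1≡ι n))))

fromℕ-* : ∀ m n → fromℕ (m ℕ.* n) ≐ fromℕ m * fromℕ n
fromℕ-* m n i = trans (/1≡ι (m ℕ.* n)) (trans (ι-* m n) (sym (cong₂ ℚ._*_ (/1≡ι m) (/1≡ι n))))

fromℕ-∑ : ∀ (f : ℕ → ℕ) n → fromℕ (Summation.∑∈ (upTo n) f) ≐ ∑ (fromℕ ∘ f) n
fromℕ-∑ f zero    i = refl
fromℕ-∑ f (suc n) i = trans (cong (λ m → seq (fromℕ m) i) (Summation.∑∈-upTo-suc f n))
  (trans (fromℕ-+ (Summation.∑∈ (upTo n) f) (f n) i) (cong (ℚ._+ seq (fromℕ (f n)) i) (fromℕ-∑ f n i)))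

-- Limits and sums of series

-- A variant of _⟶_ without the slack in the definition of _<_ on ℝ.
_⟶′_ : (ℕ → ℝ) → ℝ → Set
f ⟶′ l = ∀ ε → 0ℚ ℚ.< ε → Eventually λ n → Eventually λ i → Close ε (seq (f n) i) (seq l i)

⟶⇒⟶′ : ∀ f l → f ⟶ l → f ⟶′ l
⟶⇒⟶′ f l f⟶l ε 0<ε = eventually-map
  (λ {n} (δ , 0<δ , h) → eventually-map
    (λ {i} ∣f-l∣+δ≤ε → ℚ.<-≤-trans
      (subst (ℚ._< ∣f-l∣ n i ℚ.+ δ) (ℚ.+-identityʳ (∣f-l∣ n i)) (ℚ.+-monoʳ-< (∣f-l∣ n i) 0<δ))
      ∣f-l∣+δ≤ε) h)
  (f⟶l ε 0<ε)
  where
  ∣f-l∣ : ℕ → ℕ → ℚ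
  ∣f-l∣ n i = ℚ.∣ seq (f n) i ℚ.- seq l i ∣

-- Aiming at a third of `ε` leaves another third as the positive gap that `_<_` on reals demands.
⟶′⇒⟶ : ∀ f l → f ⟶′ l → f ⟶ l
⟶′⇒⟶ f l f⟶l ε 0<ε = eventually-map
  (λ {n} h → third ε , third-pos 0<ε , eventually-map
    (λ {i} f≈l → ℚ.≤-trans (ℚ.+-monoˡ-≤ (third ε) (ℚ.<⇒≤ f≈l)) (ℚ.<⇒≤ (two-thirds 0<ε))) h)
  (f⟶l (third ε) (third-pos 0<ε))

hasSum-≐ : ∀ f g s t → (∀ k → f k ≐ g k) → s ≐ t → f HasSum s → g HasSum t
hasSum-≐ f g s t f≐g s≐t f-s = ⟶′⇒⟶ (∑ g) t λ ε 0<ε → eventually-map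
  (λ {n} → eventually-map (λ {i} → subst₂ (Close ε) (∑-≐ f≐g n i) (s≐t i)))
  (⟶⇒⟶′ (∑ f) s f-s ε 0<ε)

hasSum-0 : (λ _ → 0ℝ) HasSum 0ℝ
hasSum-0 = ⟶′⇒⟶ (∑ λ _ → 0ℝ) 0ℝ λ ε 0<ε → 0 , λ n _ → 0 , λ i _ →
  close-refl {ε} 0<ε (∑-0 n i)
  where
  ∑-0 : ∀ n → ∑ (λ _ → 0ℝ) n ≐ 0ℝ
  ∑-0 zero    i = refl
  ∑-0 (suc n) i = trans (ℚ.+-identityʳ _) (∑-0 n i)

hasSum-+ : ∀ f g s t → f HasSum s → g HasSum t → (λ k → f k + g k) HasSum (s + t)
hasSum-+ f g s t f-s g-t = ⟶′⇒⟶ (∑ λ k → f k + g k) (s + t) λ ε 0<ε → eventually-zip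
  (λ {n} → eventually-zip (λ {i} f≈s g≈t →
    subst (λ p → Close ε p (seq s i ℚ.+ seq t i)) (sym (∑-+ f g n i))
      (close-+ {ε} (seq (∑ f n) i) (seq (∑ g n) i) (seq s i) (seq t i) 0<ε f≈s g≈t)))
  (⟶⇒⟶′ (∑ f) s f-s (third ε) (third-pos 0<ε))
  (⟶⇒⟶′ (∑ g) t g-t (third ε) (third-pos 0<ε))

⟶′-* : ∀ x f l → f ⟶′ l → (λ n → x * f n) ⟶′ (x * l)
⟶′-* x f l f⟶l ε 0<ε = scale (CauchyFacts.bounded {seq x} (cauchy x))
  where
  scale : CauchyFacts.EventuallyBounded (seq x) →
          Eventually λ n → Eventually λ i → Close ε (seq x i ℚ.* seq (f n) i) (seq x i ℚ.* seq l i)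
  scale (K , 0<K , x≤K) = eventually-map
    (λ {n} → eventually-zip (λ {i} → close-* {ε} {K} (seq x i) (seq (f n) i) (seq l i) 0<K) x≤K)
    (f⟶l (ε ℚ.* recip K) (*-pos {ε} {recip K} 0<ε (recip-pos 0<K)))

∑-* : ∀ x f n → ∑ (λ k → x * f k) n ≐ x * ∑ f n
∑-* x f zero    i = sym (ℚ.*-zeroʳ (seq x i))
∑-* x f (suc n) i = trans (cong (ℚ._+ seq x i ℚ.* seq (f n) i) (∑-* x f n i))
  (sym (ℚ.*-distribˡ-+ (seq x i) (seq (∑ f n) i) (seq (f n) i)))

hasSum-* : ∀ x f s → f HasSum s → (λ k → x * f k) HasSum (x * s)
hasSum-* x f s f-s = ⟶′⇒⟶ (∑ λ k → x * f k) (x * s) λ ε 0<ε → eventually-map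
  (λ {n} → eventually-map (λ {i} → subst (λ p → Close ε p (seq x i ℚ.* seq s i)) (sym (∑-* x f n i))))
  (⟶′-* x (∑ f) s (⟶⇒⟶′ (∑ f) s f-s) ε 0<ε)

hasSum-shift : ∀ f s → f 0 ≐ 0ℝ → (f ∘ suc) HasSum s → f HasSum s
hasSum-shift f s f0≐0 f-s = ⟶′⇒⟶ (∑ f) s λ ε 0<ε → shift ε (⟶⇒⟶′ (∑ (f ∘ suc)) s f-s ε 0<ε)
  where
  ∑-shift : ∀ n → ∑ f (suc n) ≐ ∑ (f ∘ suc) n
  ∑-shift zero    i = trans (ℚ.+-identityˡ _) (f0≐0 i)
  ∑-shift (suc n) i = cong (ℚ._+ seq (f (suc n)) i) (∑-shift n i)
  shift : ∀ ε → Eventually (λ n → Eventually λ i → Close ε (seq (∑ (f ∘ suc) n) i) (seq s i)) →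
                Eventually (λ n → Eventually λ i → Close ε (seq (∑ f n) i) (seq s i))
  -- From `suc N` on every index is a successor, and its partial sum is that of the shifted series
  -- at the predecessor.
  shift ε (N , h) = suc N , λ { (suc n) (ℕ.s≤s N≤n) →
    eventually-map (λ {i} → subst (λ p → Close ε p (seq s i)) (sym (∑-shift n i))) (h n N≤n) }

hasSum-∑ : ∀ (c s : ℕ → ℝ) (f : ℕ → ℕ → ℝ) → (∀ j → f j HasSum s j) →
  ∀ m → (λ k → ∑ (λ j → c j * f j k) m) HasSum ∑ (λ j → c j * s j) m
hasSum-∑ c s f f-s zero    = hasSum-0
hasSum-∑ c s f f-s (suc m) = hasSum-+
  (λ k → ∑ (λ j → c j * f j k) m) (λ k → c m * f m k) (∑ (λ j → c j * s j) m) (c m * s m)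
  (hasSum-∑ c s f f-s m) (hasSum-* (c m) (f m) (s m) (f-s m))

-- Series with falling factorials and powers of the index

pow : ℝ → ℕ → ℝ
pow x zero    = 1ℝ
pow x (suc k) = x * pow x k

pow≐^ : ∀ x k → pow x k ≐ x ^ k
pow≐^ x zero    i = refl
pow≐^ x (suc k) i = cong (seq x i ℚ.*_) (pow≐^ x k i)

fallingTerm : ℝ → ℕ → ℕ → ℝ
fallingTerm x j k = pow x k * fromℕ (Stirling.falling k j) /! k

-- `(k+1)_{j+1} / (k+1)! = (k)_j / k!`, as numerator and denominator gain the same factor `k+1`.
fallingTerm-suc : ∀ x j k → x * fallingTerm x j k ≐ fallingTerm x (suc j) (suc k)
fallingTerm-suc x j k i = begin-equality
  p ℚ.* (q ℚ.* f ℚ.* invFact k)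
    ≡⟨ cong (λ v → p ℚ.* (q ℚ.* f ℚ.* v)) (invFact-suc k) ⟨
  p ℚ.* (q ℚ.* f ℚ.* (invFact (suc k) ℚ.* ι (suc k)))
    ≡⟨ solve 5 (λ p q f v c → p :* (q :* f :* (v :* c)) := p :* q :* (c :* f) :* v) refl
         p q f (invFact (suc k)) (ι (suc k)) ⟩
  p ℚ.* q ℚ.* (ι (suc k) ℚ.* f) ℚ.* invFact (suc k)
    ≡⟨ cong (λ v → p ℚ.* q ℚ.* (v ℚ.* f) ℚ.* invFact (suc k)) (/1≡ι (suc k)) ⟨
  p ℚ.* q ℚ.* (seq (fromℕ (suc k)) i ℚ.* f) ℚ.* invFact (suc k)
    ≡⟨ cong (λ v → p ℚ.* q ℚ.* v ℚ.* invFact (suc k)) (fromℕ-* (suc k) (Stirling.falling k j) i) ⟨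
  p ℚ.* q ℚ.* seq (fromℕ (Stirling.falling (suc k) (suc j))) i ℚ.* invFact (suc k) ∎
  where
  p q f : ℚ
  p = seq x i
  q = seq (pow x k) i
  f = seq (fromℕ (Stirling.falling k j)) i

-- Induction on `j`: multiplying the series for `j` by `x` yields the series for `suc j` without its
-- term at `0`, which is zero because `(0)_{j+1} = 0`. The case `j = 0` is the exponential series.
hasSum-fallingTerm : ∀ x j → fallingTerm x j HasSum (pow x j * exp x)
hasSum-fallingTerm x zero = hasSum-≐ (expTerm x) (fallingTerm x zero) (exp x) (pow x zero * exp x)
  (λ k i → cong (ℚ._* invFact k) (trans (sym (pow≐^ x k i)) (sym (ℚ.*-identityʳ (seq (pow x k) i)))))
  (λ i → sym (ℚ.*-identityˡ (seq (exp x) i)))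
  (exp-hasSum x)
hasSum-fallingTerm x (suc j) = hasSum-shift (fallingTerm x (suc j)) (pow x (suc j) * exp x) (λ i → refl)
  (hasSum-≐ (λ k → x * fallingTerm x j k) (λ k → fallingTerm x (suc j) (suc k))
    (x * (pow x j * exp x)) (pow x (suc j) * exp x)
    (fallingTerm-suc x j)
    (λ i → sym (ℚ.*-assoc (seq x i) (seq (pow x j) i) (seq (exp x) i)))
    (hasSum-* x (fallingTerm x j) (pow x j * exp x) (hasSum-fallingTerm x j)))

powerTerm-≐ : ∀ x n k →
  ∑ (λ j → fromℕ (stirling₂ n j) * fallingTerm x j k) (suc n) ≐ pow x k * fromℕ (k ℕ.^ n) /! k
powerTerm-≐ x n k i = begin-equality
  seq (∑ (λ j → fromℕ (stirling₂ n j) * fallingTerm x j k) (suc n)) i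
    ≡⟨ factor (suc n) ⟩
  q ℚ.* seq (∑ (λ j → fromℕ (stirling₂ n j ℕ.* Stirling.falling k j)) (suc n)) i ℚ.* invFact k
    ≡⟨ cong (λ v → q ℚ.* v ℚ.* invFact k) (fromℕ-∑ (λ j → stirling₂ n j ℕ.* Stirling.falling k j) (suc n) i) ⟨
  q ℚ.* seq (fromℕ (Summation.∑∈ (upTo (suc n)) (λ j → stirling₂ n j ℕ.* Stirling.falling k j))) i ℚ.* invFact k
    ≡⟨ cong (λ m → q ℚ.* seq (fromℕ m) i ℚ.* invFact k) (Stirling.^-stirling₂ k n) ⟨
  q ℚ.* seq (fromℕ (k ℕ.^ n)) i ℚ.* invFact k ∎
  where
  q : ℚ
  q = seq (pow x k) i
  factor : ∀ m → seq (∑ (λ j → fromℕ (stirling₂ n j) * fallingTerm x j k) m) i ≡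
                 q ℚ.* seq (∑ (λ j → fromℕ (stirling₂ n j ℕ.* Stirling.falling k j)) m) i ℚ.* invFact k
  factor zero    = solve 2 (λ q v → con 0ℚ := q :* con 0ℚ :* v) refl q (invFact k)
  factor (suc m) = trans
    (cong (ℚ._+ a ℚ.* (q ℚ.* b ℚ.* invFact k)) (factor m))
    (trans
      (solve 5 (λ q s v a b → q :* s :* v :+ a :* (q :* b :* v) := q :* (s :+ a :* b) :* v) refl
        q s (invFact k) a b)
      (cong (λ c → q ℚ.* (s ℚ.+ c) ℚ.* invFact k) (sym (fromℕ-* (stirling₂ n m) (Stirling.falling k m) i))))
    where
    a b s : ℚ
    a = seq (fromℕ (stirling₂ n m)) i
    b = seq (fromℕ (Stirling.falling k m)) i
    s = seq (∑ (λ j → fromℕ (stirling₂ n j ℕ.* Stirling.falling k j)) m) i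

-- A record type, so that f and g can be inferred from it. Comparing two terms
-- containing the ring power _^_ may unfold Cauchy proofs, hence the use of pow
-- and of inference wherever _^_ occurs.
record _≗ℝ_ (f g : ℕ → ℝ) : Set where
  constructor pointwise
  field at : ∀ k → f k ≐ g k
open _≗ℝ_

pow-powerTerm : ∀ x n → (λ k → pow x k * fromℕ (k ℕ.^ n) /! k) ≗ℝ (λ k → x ^ k * fromℕ (k ℕ.^ n) /! k)
pow-powerTerm x n = pointwise λ k i → cong (λ q → q ℚ.* seq (fromℕ (k ℕ.^ n)) i ℚ.* invFact k) (pow≐^ x k i)

-- The sum over `j` is finite, so interchanging it with the series over `k` is linearity of
-- `_HasSum_`, and convergence comes with it.
hasSum-powTerm : ∀ x n {g} → (λ k → pow x k * fromℕ (k ℕ.^ n) /! k) ≗ℝ g →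
  g HasSum ∑ (λ j → fromℕ (stirling₂ n j) * (pow x j * exp x)) (suc n)
hasSum-powTerm x n {g} pow≗g = hasSum-≐
  (λ k → ∑ (λ j → fromℕ (stirling₂ n j) * fallingTerm x j k) (suc n)) g
  (∑ (λ j → fromℕ (stirling₂ n j) * (pow x j * exp x)) (suc n))
  (∑ (λ j → fromℕ (stirling₂ n j) * (pow x j * exp x)) (suc n))
  (λ k i → trans (powerTerm-≐ x n k i) (at pow≗g k i))
  (λ i → refl)
  (hasSum-∑ (λ j → fromℕ (stirling₂ n j)) (λ j → pow x j * exp x) (fallingTerm x) (hasSum-fallingTerm x) (suc n))

-- Division by the exponential

∑ℚ-cancel : ∀ p r e (c q : ℕ → ℚ) → r ℚ.* e ≡ 1ℚ → ∀ m →
  p ℚ.* r ℚ.* ∑ℚ (λ j → c j ℚ.* (q j ℚ.* e)) m ≡ ∑ℚ (λ j → c j ℚ.* (p ℚ.* q j)) m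
∑ℚ-cancel p r e c q re≡1 zero    = ℚ.*-zeroʳ (p ℚ.* r)
∑ℚ-cancel p r e c q re≡1 (suc m) = begin-equality
  p ℚ.* r ℚ.* (s ℚ.+ c m ℚ.* (q m ℚ.* e))
    ≡⟨ solve 6 (λ p r s c q e → p :* r :* (s :+ c :* (q :* e)) := p :* r :* s :+ c :* (p :* q) :* (r :* e)) refl
         p r s (c m) (q m) e ⟩
  p ℚ.* r ℚ.* s ℚ.+ c m ℚ.* (p ℚ.* q m) ℚ.* (r ℚ.* e)
    ≡⟨ cong₂ (λ a b → a ℚ.+ c m ℚ.* (p ℚ.* q m) ℚ.* b) (∑ℚ-cancel p r e c q re≡1 m) re≡1 ⟩
  t ℚ.+ c m ℚ.* (p ℚ.* q m) ℚ.* 1ℚ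
    ≡⟨ cong (t ℚ.+_) (ℚ.*-identityʳ (c m ℚ.* (p ℚ.* q m))) ⟩
  t ℚ.+ c m ℚ.* (p ℚ.* q m) ∎
  where
  s t : ℚ
  s = ∑ℚ (λ j → c j ℚ.* (q j ℚ.* e)) m
  t = ∑ℚ (λ j → c j ℚ.* (p ℚ.* q j)) m

-- Every summand contains the factor `y` once. The approximations of `y` are invertible only from
-- the index on where `y` is bounded away from `0`, hence `_≃_` and not `_≐_`.
÷-*-cancel : ∀ x y (c q : ℕ → ℝ) m (y#0 : y # 0ℝ) →
  x ÷ y ⟨ y#0 ⟩ * ∑ (λ j → c j * (q j * y)) m ≃ ∑ (λ j → c j * (x * q j)) m
÷-*-cancel x y c q m y#0 = eventually-≡⇒≃
  (x ÷ y ⟨ y#0 ⟩ * ∑ (λ j → c j * (q j * y)) m) (∑ (λ j → c j * (x * q j)) m) (eventually-map (λ {i} → cancel i)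
  (nonzero (#0⇒boundedAway y y#0)))
  where
  nonzero : CauchyFacts.BoundedAway (seq y) →
            Eventually λ i → recip (seq y i) ℚ.* seq y i ≡ 1ℚ
  nonzero (δ , 0<δ , δ≤y) = eventually-map
    (λ {i} δ≤∣y∣ → recip-inverse λ y≡0 → <⇒≱ 0<δ (subst (λ e → δ ℚ.≤ ℚ.∣ e ∣) y≡0 δ≤∣y∣)) δ≤y
  cancel : ∀ i → recip (seq y i) ℚ.* seq y i ≡ 1ℚ →
    seq x i ℚ.* recip (seq y i) ℚ.* seq (∑ (λ j → c j * (q j * y)) m) i ≡ seq (∑ (λ j → c j * (x * q j)) m) i
  cancel i ry≡1 = trans
    (cong (seq x i ℚ.* recip (seq y i) ℚ.*_) (seq-∑ (λ j → c j * (q j * y)) m i))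
    (trans (∑ℚ-cancel (seq x i) (recip (seq y i)) (seq y i) (λ j → seq (c j) i) (λ j → seq (q j) i) ry≡1 m)
      (sym (seq-∑ (λ j → c j * (x * q j)) m i)))

÷exp-cancel : ∀ x n (e#0 : exp x # 0ℝ) →
  x ÷ exp x ⟨ e#0 ⟩ * ∑ (λ j → fromℕ (stirling₂ n j) * (pow x j * exp x)) (suc n) ≃ ∑ (λ j → fromℕ (stirling₂ n j) * (x * pow x j)) (suc n)
÷exp-cancel x n e#0 = ÷-*-cancel x (exp x) (λ j → fromℕ (stirling₂ n j)) (pow x) (suc n) e#0

-- Lucas numbers as power sums of the two roots

-- Both roots satisfy p² - p - 1 = (s² - 5) / 4.
quadratic-expand : ∀ s a b {p q} → p ≡ (1ℚ ℚ.+ s) ℚ.* ½ → q ≡ (1ℚ ℚ.- s) ℚ.* ½ →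
  p ℚ.* (p ℚ.* a) ℚ.+ q ℚ.* (q ℚ.* b) ≡
  (p ℚ.* a ℚ.+ q ℚ.* b ℚ.+ (a ℚ.+ b) ℚ.* (ℚ.- (+ 1 ℚ./ 4))) ℚ.+ (a ℚ.+ b) ℚ.* (+ 1 ℚ./ 4) ℚ.* (s ℚ.* s)
quadratic-expand s a b refl refl = solve 3 (λ s a b →
  let p = (con 1ℚ :+ s) :* con ½ ; q = (con 1ℚ :- s) :* con ½ in
  p :* (p :* a) :+ q :* (q :* b) :=
  (p :* a :+ q :* b :+ (a :+ b) :* con (ℚ.- (+ 1 ℚ./ 4))) :+ (a :+ b) :* con (+ 1 ℚ./ 4) :* (s :* s)) refl s a b

quadratic-collect : ∀ a b →
  (a ℚ.+ b ℚ.* (ℚ.- (+ 1 ℚ./ 4))) ℚ.+ b ℚ.* (+ 1 ℚ./ 4) ℚ.* (+ 5 ℚ./ 1) ≡ a ℚ.+ b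
quadratic-collect = solve 2 (λ a b →
  (a :+ b :* con (ℚ.- (+ 1 ℚ./ 4))) :+ b :* con (+ 1 ℚ./ 4) :* con (+ 5 ℚ./ 1) := a :+ b) refl

-- The roots are kept abstract: the argument rests on `s * s ≃ fromℕ 5` and on how `p` and `q` are
-- expressed through `s`, not on the way square roots are approximated.
module GoldenPowers (s p q : ℝ) (s²≃5 : s * s ≃ fromℕ 5)
  (p≡ : ∀ i → seq p i ≡ (1ℚ ℚ.+ seq s i) ℚ.* ½) (q≡ : ∀ i → seq q i ≡ (1ℚ ℚ.- seq s i) ℚ.* ½) where

  powerSum : ℕ → ℝ
  powerSum m = pow p m + pow q m

  powerSum-1 : powerSum 1 ≐ fromℕ 1
  powerSum-1 i = trans (cong₂ (λ a b → a ℚ.* 1ℚ ℚ.+ b ℚ.* 1ℚ) (p≡ i) (q≡ i))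
    (solve 1 (λ s → (con 1ℚ :+ s) :* con ½ :* con 1ℚ :+ (con 1ℚ :- s) :* con ½ :* con 1ℚ := con 1ℚ) refl (seq s i))

  -- Since `s * s` is 5 only in the limit, an exact identity first isolates it as one factor,
  -- `*-congˡ` then replaces it, and a second exact identity collects terms by `-1/4 + 5/4 = 1`.
  powerSum-suc-suc : ∀ m → powerSum (2 ℕ.+ m) ≃ powerSum (suc m) + powerSum m
  powerSum-suc-suc m =
    ≃-trans (powerSum (2 ℕ.+ m)) (d + c * (s * s)) (powerSum (suc m) + powerSum m)
      (≐⇒≃ (powerSum (2 ℕ.+ m)) (d + c * (s * s))
        λ i → quadratic-expand (seq s i) (seq (pow p m) i) (seq (pow q m) i) (p≡ i) (q≡ i))
    (≃-trans (d + c * (s * s)) (d + c * fromℕ 5) (powerSum (suc m) + powerSum m)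
      (+-cong d (c * (s * s)) d (c * fromℕ 5) (≐⇒≃ d d λ _ → refl) (*-congˡ c (s * s) (fromℕ 5) s²≃5))
      (≐⇒≃ (d + c * fromℕ 5) (powerSum (suc m) + powerSum m)
        λ i → quadratic-collect (seq (powerSum (suc m)) i) (seq (powerSum m) i)))
    where
    c d : ℝ
    c = powerSum m * fromℚ (+ 1 ℚ./ 4)
    d = powerSum (suc m) + powerSum m * fromℚ (ℚ.- (+ 1 ℚ./ 4))

  powerSum≃lucas : ∀ m → powerSum m ≃ fromℕ (lucas m)
  powerSum≃lucas 0 = ≐⇒≃ (powerSum 0) (fromℕ 2) (λ i → refl)
  powerSum≃lucas 1 = ≐⇒≃ (powerSum 1) (fromℕ 1) powerSum-1
  powerSum≃lucas (suc (suc m)) =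
    ≃-trans (powerSum (2 ℕ.+ m)) (powerSum (suc m) + powerSum m) (fromℕ (lucas (2 ℕ.+ m)))
      (powerSum-suc-suc m)
    (≃-trans (powerSum (suc m) + powerSum m) (fromℕ (lucas (suc m)) + fromℕ (lucas m)) (fromℕ (lucas (2 ℕ.+ m)))
      (+-cong (powerSum (suc m)) (powerSum m) (fromℕ (lucas (suc m))) (fromℕ (lucas m))
        (powerSum≃lucas (suc m)) (powerSum≃lucas m))
      (≐⇒≃ (fromℕ (lucas (suc m)) + fromℕ (lucas m)) (fromℕ (lucas (2 ℕ.+ m)))
        λ i → sym (fromℕ-+ (lucas (suc m)) (lucas m) i)))

  -- The factor `p` in front of `pow p j` is the numerator of the quotient by the exponential; it
  -- raises the exponent to `suc j` and so accounts for the shifted index of the Lucas number.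
  ∑-powers≃lucasFubini : ∀ n →
    ∑ (λ j → fromℕ (stirling₂ n j) * (p * pow p j)) (suc n) +
    ∑ (λ j → fromℕ (stirling₂ n j) * (q * pow q j)) (suc n) ≃ fromℕ (lucasFubini n)
  ∑-powers≃lucasFubini n =
    ≃-trans (∑ a (suc n) + ∑ b (suc n)) (∑ c (suc n)) (fromℕ (lucasFubini n))
      (≐⇒≃ (∑ a (suc n) + ∑ b (suc n)) (∑ c (suc n)) merge)
    (≃-trans (∑ c (suc n)) (∑ d (suc n)) (fromℕ (lucasFubini n))
      (∑-≃ c d (λ j → *-congˡ (fromℕ (stirling₂ n j)) (powerSum (suc j)) (fromℕ (lucas (suc j)))
        (powerSum≃lucas (suc j))) (suc n))
      (≐⇒≃ (∑ d (suc n)) (fromℕ (lucasFubini n)) collect))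
    where
    a b c d : ℕ → ℝ
    a j = fromℕ (stirling₂ n j) * (p * pow p j)
    b j = fromℕ (stirling₂ n j) * (q * pow q j)
    c j = fromℕ (stirling₂ n j) * powerSum (suc j)
    d j = fromℕ (stirling₂ n j) * fromℕ (lucas (suc j))
    merge : ∑ a (suc n) + ∑ b (suc n) ≐ ∑ c (suc n)
    merge i = trans (sym (∑-+ a b (suc n) i))
      (∑-≐ {λ j → a j + b j} {c}
        (λ j i → sym (ℚ.*-distribˡ-+ (seq (fromℕ (stirling₂ n j)) i) (seq (p * pow p j) i) (seq (q * pow q j) i))) (suc n) i)
    collect : ∑ d (suc n) ≐ fromℕ (lucasFubini n)
    collect i = trans
      (∑-≐ {d} {λ j → fromℕ (lucas (suc j) ℕ.* stirling₂ n j)}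
        (λ j i → trans (ℚ.*-comm (seq (fromℕ (stirling₂ n j)) i) (seq (fromℕ (lucas (suc j))) i))
          (sym (fromℕ-* (lucas (suc j)) (stirling₂ n j) i))) (suc n) i)
      (sym (fromℕ-∑ (λ j → lucas (suc j) ℕ.* stirling₂ n j) (suc n) i))

-- The exponential does not vanish at α and β

-- A single partial sum close to the limit suffices: being at least `δ` and within `third δ` of
-- `exp x`, it keeps `exp x` above `third δ`. The lower bound is asked for at all `i` since
-- convergence fixes `n` before it controls the approximations in `i`.
exp#0 : ∀ x δ → 0ℚ ℚ.< δ → Eventually (λ n → ∀ i → δ ℚ.≤ ∑ℚ (expTermℚ (seq x i)) n) → exp x # 0ℝ
exp#0 x δ 0<δ δ≤∑ = inj₂ (t , third-pos 0<δ , positive (proj₁ witness) (proj₂ witness (proj₁ witness) ℕ.≤-refl))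
  where
  t : ℚ
  t = third δ
  witness : Eventually λ n → (∀ i → δ ℚ.≤ ∑ℚ (expTermℚ (seq x i)) n) ×
                             Eventually λ i → Close t (seq (∑ (expTerm x) n) i) (seq (exp x) i)
  witness = eventually-zip (λ {n} → _,_) δ≤∑ (⟶⇒⟶′ (∑ (expTerm x)) (exp x) (exp-hasSum x) t (third-pos 0<δ))
  bound : ∀ n i → δ ℚ.≤ ∑ℚ (expTermℚ (seq x i)) n →
          Close t (seq (∑ (expTerm x) n) i) (seq (exp x) i) → 0ℚ ℚ.+ t ℚ.≤ seq (exp x) i
  bound n i δ≤s s≈e = subst (ℚ._≤ e) (sym (ℚ.+-identityˡ t)) (ℚ.≮⇒≥ λ e<t → <⇒≱ (begin-strict
    s             <⟨ <-+-∣-∣ s s≈e ⟩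
    e ℚ.+ t       <⟨ ℚ.+-monoˡ-< t e<t ⟩
    t ℚ.+ t       <⟨ two-thirds 0<δ ⟩
    δ             ∎) (subst (δ ℚ.≤_) (sym (seq-∑-expTerm x n i)) δ≤s))
    where
    s e : ℚ
    s = seq (∑ (expTerm x) n) i
    e = seq (exp x) i
  positive : ∀ n → (∀ i → δ ℚ.≤ ∑ℚ (expTermℚ (seq x i)) n) ×
             Eventually (λ i → Close t (seq (∑ (expTerm x) n) i) (seq (exp x) i)) →
             Eventually λ i → 0ℚ ℚ.+ t ℚ.≤ seq (exp x) i
  positive n (δ≤s , s≈e) = eventually-map (λ {i} → bound n i (δ≤s i)) s≈e

^ℚ-nonNeg : ∀ {p} → 0ℚ ℚ.≤ p → ∀ k → 0ℚ ℚ.≤ p ^ℚ k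
^ℚ-nonNeg 0≤p zero    = 0≤ι 1
^ℚ-nonNeg 0≤p (suc k) = *-nonNeg 0≤p (^ℚ-nonNeg 0≤p k)

1≤∑expTermℚ : ∀ {p} → 0ℚ ℚ.≤ p → ∀ n → 1ℚ ℚ.≤ ∑ℚ (expTermℚ p) (suc n)
1≤∑expTermℚ     0≤p zero    = ℚ.≤-refl
1≤∑expTermℚ {p} 0≤p (suc n) = begin
  1ℚ                                                   ≡⟨ ℚ.+-identityʳ 1ℚ ⟨
  1ℚ ℚ.+ 0ℚ                                            ≤⟨ ℚ.+-mono-≤ (1≤∑expTermℚ 0≤p n)
                                                            (*-nonNeg (^ℚ-nonNeg 0≤p (suc n)) (ℚ.<⇒≤ (invFact-pos (suc n)))) ⟩
  ∑ℚ (expTermℚ p) (suc n) ℚ.+ expTermℚ p (suc n)       ∎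

square-nonNeg : ∀ p → 0ℚ ℚ.≤ p ℚ.* p
square-nonNeg p with ℚ.≤-total 0ℚ p
... | inj₁ 0≤p = *-nonNeg 0≤p 0≤p
... | inj₂ p≤0 = subst (0ℚ ℚ.≤_) (solve 1 (λ p → (:- p) :* (:- p) := p :* p) refl p)
  (*-nonNeg (ℚ.neg-antimono-≤ p≤0) (ℚ.neg-antimono-≤ p≤0))

-- The first three terms sum to ((1 + p)² + 1) / 2, and the remaining ones to
-- at most 1/3 in absolute value.
1/6≤∑expTermℚ : ∀ {p} → ℚ.∣ p ∣ ℚ.≤ 1ℚ → ∀ j → + 1 ℚ./ 6 ℚ.≤ ∑ℚ (expTermℚ p) (j ℕ.+ 3)
1/6≤∑expTermℚ {p} ∣p∣≤1 j = begin
  + 1 ℚ./ 6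
    ≡⟨ refl ⟩
  ½ ℚ.+ 0ℚ ℚ.- + 1 ℚ./ 3
    ≤⟨ ℚ.+-monoˡ-≤ (ℚ.- (+ 1 ℚ./ 3)) (ℚ.+-monoʳ-≤ ½ (*-nonNeg {p = ½} (from-yes (0ℚ ℚ.≤? ½)) (square-nonNeg (1ℚ ℚ.+ p)))) ⟩
  ½ ℚ.+ ½ ℚ.* ((1ℚ ℚ.+ p) ℚ.* (1ℚ ℚ.+ p)) ℚ.- + 1 ℚ./ 3
    ≡⟨ cong (ℚ._- + 1 ℚ./ 3) (solve 1 (λ p → con ½ :+ con ½ :* ((con 1ℚ :+ p) :* (con 1ℚ :+ p)) :=
         con 0ℚ :+ con 1ℚ :* con 1ℚ :+ p :* con 1ℚ :* con 1ℚ :+ p :* (p :* con 1ℚ) :* con ½) refl p) ⟩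
  s₃ ℚ.- + 1 ℚ./ 3
    ≤⟨ ℚ.+-monoʳ-≤ s₃ (ℚ.neg-antimono-≤ close) ⟩
  s₃ ℚ.- ℚ.∣ s ℚ.- s₃ ∣
    ≤⟨ ℚ.+-monoʳ-≤ s₃ (ℚ.neg-antimono-≤ (subst (s₃ ℚ.- s ℚ.≤_) (∣-∣-sym s₃ s) (≤-∣∣ (s₃ ℚ.- s)))) ⟩
  s₃ ℚ.- (s₃ ℚ.- s)
    ≡⟨ solve 2 (λ a b → a :- (a :- b) := b) refl s₃ s ⟩
  s ∎
  where
  -- For `B = 0` the radius `b` is `1` and `t k` is `1 / k!`, so the tail after three terms is at
  -- most `2 / 3! = 1/3`.
  open ExpTail 0 using (t; t≥0; tail)
  s s₃ : ℚ
  s  = ∑ℚ (expTermℚ p) (j ℕ.+ 3)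
  s₃ = ∑ℚ (expTermℚ p) 3
  close : ℚ.∣ s ℚ.- s₃ ∣ ℚ.≤ + 1 ℚ./ 3
  close = begin
    ℚ.∣ s ℚ.- s₃ ∣                                  ≡⟨ ℚ.+-identityʳ _ ⟨
    ℚ.∣ s ℚ.- s₃ ∣ ℚ.+ 0ℚ                           ≤⟨ ℚ.+-monoʳ-≤ ℚ.∣ s ℚ.- s₃ ∣ (ℚ.+-mono-≤ (t≥0 (j ℕ.+ 3)) (t≥0 (j ℕ.+ 3))) ⟩
    ℚ.∣ s ℚ.- s₃ ∣ ℚ.+ (t (j ℕ.+ 3) ℚ.+ t (j ℕ.+ 3)) ≤⟨ tail {p} ∣p∣≤1 3 j (ℕ.s≤s (ℕ.s≤s ℕ.z≤n)) ⟩
    t 3 ℚ.+ t 3                                     ≡⟨ refl ⟩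
    + 1 ℚ./ 3                                       ∎

α-nonNeg : ∀ i → 0ℚ ℚ.≤ seq α i
α-nonNeg i = *-nonNeg {q = ½} (ℚ.+-mono-≤ (0≤ι 1) (√-seq-nonNeg 5 i)) (from-yes (0ℚ ℚ.≤? ½))

-- The crude bound `3` is just what puts `(1 - s) / 2` at or above `-1`, the radius of the tail
-- estimate.
√5≤3 : ∀ i → seq (√ 5) i ℚ.≤ ι 3
√5≤3 i = ℚ.<⇒≤ (square-cancel-< (0≤ι 3) (ℚ.≤-<-trans (√-seq-lower 5 i) (from-yes (ι 5 ℚ.<? ι 3 ℚ.* ι 3))))

∣p∣≤q : ∀ {p q} → p ℚ.≤ q → ℚ.- p ℚ.≤ q → ℚ.∣ p ∣ ℚ.≤ q
∣p∣≤q {p} {q} p≤q -p≤q with ℚ.∣p∣≡p∨∣p∣≡-p p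
... | inj₁ eq = subst (ℚ._≤ q) (sym eq) p≤q
... | inj₂ eq = subst (ℚ._≤ q) (sym eq) -p≤q

∣1-s∣/2≤1 : ∀ s → 0ℚ ℚ.≤ s → s ℚ.≤ ι 3 → ℚ.∣ (1ℚ ℚ.- s) ℚ.* ½ ∣ ℚ.≤ 1ℚ
∣1-s∣/2≤1 s 0≤s s≤3 = ∣p∣≤q
  (begin
    (1ℚ ℚ.- s) ℚ.* ½  ≤⟨ *-monoʳ (from-yes (0ℚ ℚ.≤? ½)) (ℚ.+-monoʳ-≤ 1ℚ (ℚ.neg-antimono-≤ 0≤s)) ⟩
    (1ℚ ℚ.- 0ℚ) ℚ.* ½ ≤⟨ from-yes ((1ℚ ℚ.- 0ℚ) ℚ.* ½ ℚ.≤? 1ℚ) ⟩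
    1ℚ                ∎)
  (begin
    ℚ.- ((1ℚ ℚ.- s) ℚ.* ½) ≡⟨ solve 1 (λ s → :- ((con 1ℚ :- s) :* con ½) := (s :- con 1ℚ) :* con ½) refl s ⟩
    (s ℚ.- 1ℚ) ℚ.* ½       ≤⟨ *-monoʳ (from-yes (0ℚ ℚ.≤? ½)) (ℚ.+-monoˡ-≤ (ℚ.- 1ℚ) s≤3) ⟩
    (ι 3 ℚ.- 1ℚ) ℚ.* ½     ≡⟨ refl ⟩
    1ℚ                     ∎)

∣β∣≤1 : ∀ i → ℚ.∣ seq β i ∣ ℚ.≤ 1ℚ
∣β∣≤1 i = ∣1-s∣/2≤1 (seq (√ 5) i) (√-seq-nonNeg 5 i) (√5≤3 i)

expα#0 : exp α # 0ℝ
expα#0 = exp#0 α 1ℚ (0<ι 0) (1 , λ { (suc n) _ i → 1≤∑expTermℚ (α-nonNeg i) n })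

expβ#0 : exp β # 0ℝ
expβ#0 = exp#0 β (+ 1 ℚ./ 6) (from-yes (0ℚ ℚ.<? + 1 ℚ./ 6)) (3 , λ n 3≤n i →
  subst (λ m → + 1 ℚ./ 6 ℚ.≤ ∑ℚ (expTermℚ (seq β i)) m) (ℕ.m∸n+n≡m 3≤n) (1/6≤∑expTermℚ (∣β∣≤1 i) (n ℕ.∸ 3)))

open GoldenPowers (√ 5) α β (√-square 5) (λ i → refl) (λ i → refl)

lucasFubini≃ : ∀ n (expα#0 : exp α # 0ℝ) (expβ#0 : exp β # 0ℝ) →
  fromℕ (lucasFubini n) ≃
  α ÷ exp α ⟨ expα#0 ⟩ * ∑ (λ j → fromℕ (stirling₂ n j) * (pow α j * exp α)) (suc n) +
  β ÷ exp β ⟨ expβ#0 ⟩ * ∑ (λ j → fromℕ (stirling₂ n j) * (pow β j * exp β)) (suc n)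
lucasFubini≃ n expα#0 expβ#0 = ≃-sym (a + b) (fromℕ (lucasFubini n))
  (≃-trans (a + b) (c + d) (fromℕ (lucasFubini n))
    (+-cong a b c d (÷exp-cancel α n expα#0) (÷exp-cancel β n expβ#0))
    (∑-powers≃lucasFubini n))
  where
  a b c d : ℝ
  a = α ÷ exp α ⟨ expα#0 ⟩ * ∑ (λ j → fromℕ (stirling₂ n j) * (pow α j * exp α)) (suc n)
  b = β ÷ exp β ⟨ expβ#0 ⟩ * ∑ (λ j → fromℕ (stirling₂ n j) * (pow β j * exp β)) (suc n)
  c = ∑ (λ j → fromℕ (stirling₂ n j) * (α * pow α j)) (suc n)
  d = ∑ (λ j → fromℕ (stirling₂ n j) * (β * pow β j)) (suc n)

theorem6 : (n : ℕ) →
    Σ[ expα#0 ∈ exp α # 0ℝ ] Σ[ expβ#0 ∈ exp β # 0ℝ ]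
    Σ[ A ∈ ℝ ] Σ[ B ∈ ℝ ]
    ((λ k → α ^ k * fromℕ (k ℕ.^ n) /! k) HasSum A) ×
    ((λ k → β ^ k * fromℕ (k ℕ.^ n) /! k) HasSum B) ×
    (fromℕ (lucasFubini n) ≃ α ÷ exp α ⟨ expα#0 ⟩ * A + β ÷ exp β ⟨ expβ#0 ⟩ * B)
theorem6 n = expα#0 , expβ#0 ,
  -- Both witnesses are `e^x Σ_j S(n,j) x^j` with the exponential kept inside each summand, the form
  -- in which the division cancels it term by term.
  ∑ (λ j → fromℕ (stirling₂ n j) * (pow α j * exp α)) (suc n) ,
  ∑ (λ j → fromℕ (stirling₂ n j) * (pow β j * exp β)) (suc n) ,
  hasSum-powTerm α n (pow-powerTerm α n) , hasSum-powTerm β n (pow-powerTerm β n) ,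
  lucasFubini≃ n expα#0 expβ#0
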